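{- Let $\Gamma_1(4)^{\geq 0}$ denote the set of matrices $\begin{pmatrix} a & b\\ c & d\end{pmatrix}\in\mathrm{SL}(2,\mathbb{Z})$ with $a,b,c,d\geq 0$, $a\equiv d\equiv 1\pmod 4$ and $c\equiv 0\pmod 4$. Let \[\Psi:=\left\{\begin{pmatrix} a & b\\ c & d\end{pmatrix}\in\Gamma_1(4)^{\geq 0}:\ \left(\tfrac{x}{y}\right)=\left(\tfrac{ax+by}{cx+dy}\right)\text{ for all } x,y\in\mathbb{Z}^{\geq 0}\text{ with } y \text{ odd}\right\}.\] Then \[\Psi=\left\{\begin{pmatrix} a & b\\ c & d\end{pmatrix}\in\Gamma_1(4)^{\geq 0}:\ \left(\tfrac{a}{b}\right)=1\right\}.\]
   Context: $\left(\frac{x}{y}\right)$ denotes the Kronecker symbol, defined for all pairs of integers; it is $\pm1$ if $x,y$ are coprime and $0$ otherwise. -}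

module Defs where

open import Data.Nat using (ℕ; zero; suc; _+_; _*_; _%_; _/_; _≡ᵇ_; _<_)
open import Data.Nat.Divisibility using (_∣_; _∣?_)
open import Data.Integer using (ℤ; +_; -_; 0ℤ; 1ℤ)
import Data.Integer as ℤ
open import Data.Bool using (Bool; true; false; if_then_else_; _∨_)
open import Data.List using (List; upTo)
open import Data.Bool.ListAction using (any)
open import Data.Product using (_×_)
open import Relation.Nullary.Decidable using (does)
open import Relation.Binary.PropositionalEquality using (_≡_)

findDiv : ℕ → ℕ → ℕ → ℕ
findDiv zero    d n = n
findDiv (suc k) d n = if does (d ∣? n) then d else findDiv k (suc d) n

minPrimeFactor : ℕ → ℕ
minPrimeFactor n = findDiv n 2 n

isSquareMod : ℕ → ℕ → Bool
isSquareMod a zero    = false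
isSquareMod a (suc k) = any (λ x → ((x * x) % suc k) ≡ᵇ (a % suc k)) (upTo (suc k))

kronPrime : ℕ → ℕ → ℤ
kronPrime a 2 =
  if (a % 2) ≡ᵇ 0 then 0ℤ
  else if ((a % 8) ≡ᵇ 1) ∨ ((a % 8) ≡ᵇ 7) then 1ℤ else - 1ℤ
kronPrime a p =
  if does (p ∣? a) then 0ℤ
  else if isSquareMod a p then 1ℤ else - 1ℤ

-- Kronecker symbol (a/n) for a, n ≥ 0, fully multiplicative in n:
--   (a/0) = 1 if a = 1 (i.e. |a| = 1), else 0;  (a/1) = 1;
--   (a/n) = (a/p)(a/(n/p)) for n ≥ 2, p the least prime factor of n.
-- The first argument is fuel (n suffices since n/p < n).
kronAux : ℕ → ℕ → ℕ → ℤ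
kronAux _       a 0 = if a ≡ᵇ 1 then 1ℤ else 0ℤ
kronAux _       a 1 = 1ℤ
kronAux zero    a n = 1ℤ
kronAux (suc f) a n = kronPrime a p ℤ.* kronAux f a (quot n p)
  where
    p : ℕ
    p = minPrimeFactor n
    -- p ≥ 2 here; the zero case only serves to avoid a NonZero argument
    quot : ℕ → ℕ → ℕ
    quot m zero    = 0
    quot m (suc q) = m / suc q

kronecker : ℕ → ℕ → ℤ
kronecker a n = kronAux n a n

{-# OPTIONS --safe #-}
module Submission where

-- For odd n = 2h + 1 coprime to a, write the Jacobi symbol as (a/n) = (-1)^(J a n), where J a n is
-- the Gauss-Schering exponent ∑_{1 ≤ i ≤ h} ⌊2ai/n⌋ mod 2. It is additive in a because i ↦ |ai mod n|
-- permutes 1, ..., h. Counting the lattice points below the line the other way gives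
-- J a n = ∑_{1 ≤ j < a} (h + ⌊jn/2a⌋), hence J a n depends only on ±n mod 4a; Euler's argument turns
-- this into J d v = J v d for d ≡ 1 (mod 4) and v odd. Additivity in n follows by reciprocity, so J
-- agrees with the Kronecker symbol as soon as it does at primes, which is Gauss's lemma combined with
-- Euler's criterion.
--
-- For the theorem put u = ax + by, v = cx + dy. If d is coprime to x, then du = x + bv and v = cx + dy
-- give (u/v) = (b/d)(x/y), and (b/d) = (a/b) because ad = 1 + bc with 4 ∣ c. In general add a multiple
-- of 4(a, b) to (c, d), which changes none of the symbols, to make d coprime to x.

open import Defs
open import Data.Nat
open import Data.Nat.Properties
open import Data.Nat.DivMod
open import Data.Nat.Divisibility
open import Data.Nat.Coprimality as Cop using (Coprime; coprime-divisor)
open import Data.Nat.GCD using (gcd; gcd[m,n]∣m; gcd[m,n]∣n; module Bézout)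
open import Data.Nat.Induction using (<-rec)
open import Data.Nat.ListAction using (product)
open import Data.Nat.ListAction.Properties using (product-++; product-↭)
open import Data.Nat.Primality using (Prime; _Rough_; 2-rough; rough⇒≤; rough∧∣⇒prime; ∤⇒rough-suc; euclidsLemma; prime⇒irreducible; prime⇒nonTrivial; ¬prime[0]; ¬prime[1])
open import Data.Nat.Tactic.RingSolver using (solve-∀)
open import Data.Integer using (ℤ; 0ℤ; 1ℤ; -1ℤ)
import Data.Integer as ℤ
import Data.Integer.Properties as ℤₚ
open import Data.Parity.Base using (Parity; 0ℙ; 1ℙ) renaming (_+_ to _⊕_)
import Data.Parity.Properties as ℙₚ
open import Algebra.Properties.CommutativeSemigroup ℙₚ.+-commutativeSemigroup using () renaming (interchange to ⊕-interchange)
open import Data.Bool.Base using (true; false; T)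
open import Data.List.Base using (List; []; _∷_; _++_; length; map; applyDownFrom; upTo)
open import Data.List.Properties using (map-applyDownFrom; length-applyDownFrom; applyDownFrom-∷ʳ; length-map)
open import Data.List.Membership.Propositional using (_∈_; find; lose)
open import Data.List.Membership.Propositional.Properties using (∈-applyDownFrom⁺; ∈-applyDownFrom⁻; ∈-upTo⁺; ∈-∃++; ∈-map⁻)
open import Data.List.Relation.Unary.Any using (here; there)
open import Data.List.Relation.Unary.Any.Properties using (any⁺; any⁻)
open import Data.List.Relation.Unary.All as All using (All)
open import Data.List.Relation.Unary.AllPairs using ([]; _∷_)
open import Data.List.Relation.Unary.Unique.Propositional using (Unique)
import Data.List.Relation.Unary.Unique.Propositional.Properties as Uniqueₚ
open import Data.List.Relation.Binary.Permutation.Propositional as ↭ using (_↭_; ↭-sym; ↭-trans; prep; ↭⇒↭ₛ)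
open import Data.List.Relation.Binary.Permutation.Propositional.Properties using (shift; ∈-resp-↭; ↭-length)
import Data.List.Relation.Binary.Permutation.Setoid.Properties as Permutationₛ
open import Data.Product using (_×_; _,_; proj₁; proj₂; ∃; ∃₂)
open import Data.Sum using (_⊎_; inj₁; inj₂)
open import Data.Empty using (⊥; ⊥-elim)
open import Function using (_∘_)
open import Relation.Nullary using (¬_; yes; no; contradiction)
open import Relation.Nullary.Decidable using (dec-true; dec-false)
open import Relation.Binary.PropositionalEquality hiding (J)

-- Sums of parities

∑ : (ℕ → Parity) → List ℕ → Parity
∑ f []       = 0ℙ
∑ f (x ∷ xs) = f x ⊕ ∑ f xs

x⊕x⊕y≡y : ∀ x y → x ⊕ (x ⊕ y) ≡ y
x⊕x⊕y≡y x y = trans (sym (ℙₚ.+-assoc x x y)) (cong (_⊕ y) (ℙₚ.p+p≡0ℙ x))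

x⊕y≡z⇒y≡x⊕z : ∀ {x y z} → x ⊕ y ≡ z → y ≡ x ⊕ z
x⊕y≡z⇒y≡x⊕z {x} {y} refl = sym (x⊕x⊕y≡y x y)

∑-cong : ∀ {f g} xs → (∀ {i} → i ∈ xs → f i ≡ g i) → ∑ f xs ≡ ∑ g xs
∑-cong []       eq = refl
∑-cong (x ∷ xs) eq = cong₂ _⊕_ (eq (here refl)) (∑-cong xs (eq ∘ there))

∑-0 : ∀ xs → ∑ (λ _ → 0ℙ) xs ≡ 0ℙ
∑-0 []       = refl
∑-0 (x ∷ xs) = ∑-0 xs

∑-⊕ : ∀ f g xs → ∑ (λ i → f i ⊕ g i) xs ≡ ∑ f xs ⊕ ∑ g xs
∑-⊕ f g []       = refl
∑-⊕ f g (x ∷ xs) = trans (cong (f x ⊕ g x ⊕_) (∑-⊕ f g xs)) (⊕-interchange (f x) (g x) _ _)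

∑-swap : ∀ (f : ℕ → ℕ → Parity) xs ys →
         ∑ (λ i → ∑ (f i) ys) xs ≡ ∑ (λ j → ∑ (λ i → f i j) xs) ys
∑-swap f []       ys = sym (∑-0 ys)
∑-swap f (x ∷ xs) ys = trans (cong (∑ (f x) ys ⊕_) (∑-swap f xs ys)) (sym (∑-⊕ (f x) _ ys))

∑-map : ∀ f φ xs → ∑ f (map φ xs) ≡ ∑ (f ∘ φ) xs
∑-map f φ []       = refl
∑-map f φ (x ∷ xs) = cong (f (φ x) ⊕_) (∑-map f φ xs)

∑-↭ : ∀ f {xs ys} → xs ↭ ys → ∑ f xs ≡ ∑ f ys
∑-↭ f ↭.refl        = refl
∑-↭ f (prep x p)    = cong (f x ⊕_) (∑-↭ f p)
∑-↭ f (↭.swap {xs} {ys} x y p) = begin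
  f x ⊕ (f y ⊕ ∑ f xs) ≡⟨ sym (ℙₚ.+-assoc (f x) (f y) _) ⟩
  (f x ⊕ f y) ⊕ ∑ f xs ≡⟨ cong₂ _⊕_ (ℙₚ.+-comm (f x) (f y)) (∑-↭ f p) ⟩
  (f y ⊕ f x) ⊕ ∑ f ys ≡⟨ ℙₚ.+-assoc (f y) (f x) _ ⟩
  f y ⊕ (f x ⊕ ∑ f ys) ∎
  where open ≡-Reasoning
∑-↭ f (↭.trans p q) = trans (∑-↭ f p) (∑-↭ f q)

parity-suc : ∀ n → parity (suc n) ≡ 1ℙ ⊕ parity n
parity-suc = ℙₚ.+-homo-+ 1

parity-2* : ∀ k → parity (2 * k) ≡ 0ℙ
parity-2* k = ℙₚ.*-homo-* 2 k

-- Every term flips once, so the total flips by the number of terms. This gives both the factor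
-- (-1)^h of (-1/n) and the passage between lattice points below and above a line.
∑-complement : ∀ {f g} xs → (∀ {i} → i ∈ xs → f i ⊕ g i ≡ 1ℙ) →
               ∑ f xs ≡ parity (length xs) ⊕ ∑ g xs
∑-complement []       eq = refl
∑-complement {f} {g} (x ∷ xs) eq = begin
  f x ⊕ ∑ f xs                             ≡⟨ cong₂ _⊕_ fx (∑-complement xs (eq ∘ there)) ⟩
  (1ℙ ⊕ g x) ⊕ (parity (length xs) ⊕ ∑ g xs) ≡⟨ ⊕-interchange 1ℙ (g x) (parity (length xs)) (∑ g xs) ⟩
  (1ℙ ⊕ parity (length xs)) ⊕ (g x ⊕ ∑ g xs) ≡⟨ cong (_⊕ (g x ⊕ ∑ g xs)) (sym (parity-suc (length xs))) ⟩
  parity (length (x ∷ xs)) ⊕ ∑ g (x ∷ xs)  ∎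
  where
  open ≡-Reasoning
  fx : f x ≡ 1ℙ ⊕ g x
  fx = trans (x⊕y≡z⇒y≡x⊕z {g x} (trans (ℙₚ.+-comm (g x) (f x)) (eq (here refl)))) (ℙₚ.+-comm (g x) 1ℙ)

-- Ranges and their permutations

range : ℕ → List ℕ
range = applyDownFrom suc

∈-range⁺ : ∀ {i n} → 1 ≤ i → i ≤ n → i ∈ range n
∈-range⁺ {suc i} _ i≤n = ∈-applyDownFrom⁺ suc i≤n

∈-range⁻ : ∀ {i n} → i ∈ range n → 1 ≤ i × i ≤ n
∈-range⁻ i∈ with _ , j<n , refl ← ∈-applyDownFrom⁻ suc i∈ = s≤s z≤n , j<n

range-unique : ∀ n → Unique (range n)
range-unique n = Uniqueₚ.applyDownFrom⁺₁ suc n λ j<i _ eq → <⇒≢ j<i (sym (suc-injective eq))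

∈-extract : ∀ {x : ℕ} {xs} → x ∈ xs → ∃ λ ys → xs ↭ x ∷ ys
∈-extract x∈xs with ys , zs , refl ← ∈-∃++ x∈xs = ys ++ zs , shift _ ys zs

∈-tail : ∀ {x y : ℕ} {xs} → x ≢ y → x ∈ y ∷ xs → x ∈ xs
∈-tail x≢y (here x≡y) = contradiction x≡y x≢y
∈-tail x≢y (there x∈) = x∈

∈⇒≢ : ∀ {x y : ℕ} {xs} → All (x ≢_) xs → y ∈ xs → y ≢ x
∈⇒≢ ≢s y∈ refl = All.lookup ≢s y∈ refl

-- Pigeonhole: extracting the entries of `ys` from `xs` one after another uses `xs` up, because the
-- lengths agree.
unique-⊆⇒↭ : ∀ {ys xs : List ℕ} → Unique ys → (∀ {y} → y ∈ ys → y ∈ xs) →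
             length xs ≡ length ys → ys ↭ xs
unique-⊆⇒↭ {[]}     {[]} u         sub len = ↭.refl
unique-⊆⇒↭ {y ∷ ys} {xs} (≢s ∷ u) sub len =
  let zs , xs↭ = ∈-extract (sub (here refl)) in
  ↭-trans (prep y (unique-⊆⇒↭ u
                    (λ z∈ → ∈-tail (∈⇒≢ ≢s z∈) (∈-resp-↭ xs↭ (sub (there z∈))))
                    (suc-injective (trans (sym (↭-length xs↭)) len))))
          (↭-sym xs↭)

-- Distinct images inside a set of the same size exhaust it. Distinctness is asked for j < i only,
-- the other order being symmetric.
injective⇒↭ : ∀ n φ → (∀ {i} → 1 ≤ i → i ≤ n → 1 ≤ φ i × φ i ≤ n) →
              (∀ {i j} → 1 ≤ j → j < i → i ≤ n → φ i ≢ φ j) →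
              map φ (range n) ↭ range n
injective⇒↭ n φ bound inj = unique-⊆⇒↭
  (subst Unique (sym (map-applyDownFrom suc φ n))
     (Uniqueₚ.applyDownFrom⁺₁ (φ ∘ suc) n λ j<i i<n → inj (s≤s z≤n) (s≤s j<i) i<n))
  sub
  (sym (length-map φ (range n)))
  where
  sub : ∀ {y} → y ∈ map φ (range n) → y ∈ range n
  sub y∈ with i , i∈ , refl ← ∈-map⁻ φ y∈ =
    let 1≤i , i≤n = ∈-range⁻ i∈
        l , u = bound 1≤i i≤n
    in ∈-range⁺ l u

-- Counting with indicators

[_≤_]? : ℕ → ℕ → Parity
[ i ≤ k ]? with i ≤? k
... | yes _ = 1ℙ
... | no  _ = 0ℙ

[≤]-yes : ∀ i k → i ≤ k → [ i ≤ k ]? ≡ 1ℙ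
[≤]-yes i k p with i ≤? k
... | yes _ = refl
... | no ¬p = contradiction p ¬p

[≤]-no : ∀ i k → ¬ (i ≤ k) → [ i ≤ k ]? ≡ 0ℙ
[≤]-no i k ¬p with i ≤? k
... | yes p = contradiction p ¬p
... | no _  = refl

-- Turns the parity of a floor into a sum of indicators, so that lattice points can be counted in
-- the other order.
∑-[≤] : ∀ n k → ∑ [_≤ k ]? (range n) ≡ parity (n ⊓ k)
∑-[≤] zero    k = refl
∑-[≤] (suc n) k with suc n ≤? k
... | yes n<k = begin
  1ℙ ⊕ ∑ [_≤ k ]? (range n)  ≡⟨ cong (1ℙ ⊕_) (∑-[≤] n k) ⟩
  1ℙ ⊕ parity (n ⊓ k)        ≡⟨ cong (λ z → 1ℙ ⊕ parity z) (m≤n⇒m⊓n≡m (<⇒≤ n<k)) ⟩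
  1ℙ ⊕ parity n              ≡⟨ sym (parity-suc n) ⟩
  parity (suc n)             ≡⟨ cong parity (sym (m≤n⇒m⊓n≡m n<k)) ⟩
  parity (suc n ⊓ k)         ∎
  where open ≡-Reasoning
... | no n≮k = trans (∑-[≤] n k) (cong parity (trans (m≥n⇒m⊓n≡n k≤n) (sym (m≥n⇒m⊓n≡n (m≤n⇒m≤1+n k≤n)))))
  where
  k≤n : k ≤ n
  k≤n = s≤s⁻¹ (≰⇒> n≮k)

-- Parities of quotients

module _ (m : ℕ) .{{_ : NonZero m}} where

  ≤/⇒*≤ : ∀ i N → i ≤ N / m → i * m ≤ N
  ≤/⇒*≤ i N le = ≤-trans (*-monoˡ-≤ m le) (m/n*n≤m N m)

  *≤⇒≤/ : ∀ i N → i * m ≤ N → i ≤ N / m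
  *≤⇒≤/ i N le = subst (_≤ N / m) (m*n/n≡m i m) (/-monoˡ-≤ m le)

  parity-/-+ : ∀ U k → parity ((U + 2 * k * m) / m) ≡ parity (U / m)
  parity-/-+ U k = begin
    parity ((U + 2 * k * m) / m)      ≡⟨ cong parity (+-distrib-/-∣ʳ U (divides (2 * k) refl)) ⟩
    parity (U / m + 2 * k * m / m)    ≡⟨ cong (λ z → parity (U / m + z)) (m*n/n≡m (2 * k) m) ⟩
    parity (U / m + 2 * k)            ≡⟨ ℙₚ.+-homo-+ (U / m) (2 * k) ⟩
    parity (U / m) ⊕ parity (2 * k)   ≡⟨ cong (parity (U / m) ⊕_) (parity-2* k) ⟩
    parity (U / m) ⊕ 0ℙ               ≡⟨ ℙₚ.+-identityʳ _ ⟩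
    parity (U / m)                    ∎
    where open ≡-Reasoning

  -- The two remainders sum to a multiple of m that is positive, because m does not divide U, and
  -- less than 2m. So it is m itself, and the quotients sum to 2k - 1.
  parity-/-complement : ∀ {U V} k → ¬ (m ∣ U) → U + V ≡ 2 * k * m →
                        parity (U / m) ⊕ parity (V / m) ≡ 1ℙ
  parity-/-complement {U} {V} k m∤U eq = go (U % m + V % m) refl m∣r+s
    where
    sum-eq : (U % m + V % m) + (U / m + V / m) * m ≡ 2 * k * m
    sum-eq = trans (trans (shuffle (U % m) (V % m) (U / m) (V / m) m)
                     (sym (cong₂ _+_ (m≡m%n+[m/n]*n U m) (m≡m%n+[m/n]*n V m)))) eq
      where
      shuffle : ∀ r s u v m → (r + s) + (u + v) * m ≡ (r + u * m) + (s + v * m)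
      shuffle = solve-∀
    m∣r+s : m ∣ U % m + V % m
    m∣r+s = ∣m+n∣m⇒∣n (subst (m ∣_) (trans (sym sum-eq) (+-comm (U % m + V % m) _)) (n∣m*n (2 * k)))
                      (n∣m*n (U / m + V / m))
    go : ∀ t → U % m + V % m ≡ t → m ∣ t → parity (U / m) ⊕ parity (V / m) ≡ 1ℙ
    go t r+s≡ (divides zero refl) = ⊥-elim (m∤U (m%n≡0⇒n∣m U m (m+n≡0⇒m≡0 _ r+s≡)))
    go t r+s≡ (divides (suc zero) refl) = begin
      parity (U / m) ⊕ parity (V / m)   ≡⟨ sym (ℙₚ.+-homo-+ (U / m) (V / m)) ⟩
      parity (U / m + V / m)
        ≡⟨ x⊕y≡z⇒y≡x⊕z {1ℙ} (trans (sym (parity-suc (U / m + V / m))) (trans (cong parity quot-eq) (parity-2* k))) ⟩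
      1ℙ                                ∎
      where
      open ≡-Reasoning
      quot-eq : suc (U / m + V / m) ≡ 2 * k
      quot-eq = *-cancelʳ-≡ _ _ m (trans (cong (_+ (U / m + V / m) * m) (trans (sym (*-identityˡ m)) (sym r+s≡))) sum-eq)
    go t r+s≡ (divides (suc (suc c)) refl) = ⊥-elim (<-irrefl r+s≡ (begin-strict
      U % m + V % m     <⟨ +-mono-< (m%n<n U m) (m%n<n V m) ⟩
      m + m             ≤⟨ +-monoʳ-≤ m (m≤m+n m (c * m)) ⟩
      m + (m + c * m)   ∎))
      where open ≤-Reasoning

-- The Gauss-Schering exponent

Odd : ℕ → Set
Odd n = ∃ λ h → n ≡ suc (2 * h)

-- q n X is 1ℙ exactly when X mod n exceeds n / 2.
q : ℕ → ℕ → Parity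
q zero      X = 0ℙ
q n@(suc _) X = parity (2 * X / n)

-- For odd n coprime to a, the Jacobi symbol (a / n) is (-1)^(J a n).
J : ℕ → ℕ → Parity
J a n = ∑ (λ i → q n (a * i)) (range (n / 2))

[1+2h]/2≡h : ∀ h → suc (2 * h) / 2 ≡ h
[1+2h]/2≡h h = trans (+-distrib-/-∣ʳ 1 {2 * h} {2} (m∣m*n h)) (trans (cong (_/ 2) (*-comm 2 h)) (m*n/n≡m h 2))

odd⇒coprime-2 : ∀ {n} → Odd n → Coprime n 2
odd⇒coprime-2 (h , refl) {d} (d∣n , d∣2) =
  ∣1⇒≡1 (∣m+n∣m⇒∣n (subst (d ∣_) (+-comm 1 (2 * h)) d∣n) (∣-trans d∣2 (m∣m*n h)))

m%n≡[m+o]%n⇒n∣o : ∀ m o n .{{_ : NonZero n}} → m % n ≡ (m + o) % n → n ∣ o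
m%n≡[m+o]%n⇒n∣o m o n eq = ∣m+n∣m⇒∣n (subst (n ∣_) multiples (n∣m*n ((m + o) / n))) (n∣m*n (m / n))
  where
  multiples : (m + o) / n * n ≡ m / n * n + o
  multiples = +-cancelˡ-≡ (m % n) _ _ (begin
    m % n + (m + o) / n * n        ≡⟨ cong (_+ (m + o) / n * n) eq ⟩
    (m + o) % n + (m + o) / n * n  ≡⟨ m≡m%n+[m/n]*n (m + o) n ⟨
    m + o                          ≡⟨ cong (_+ o) (m≡m%n+[m/n]*n m n) ⟩
    m % n + m / n * n + o          ≡⟨ +-assoc (m % n) _ o ⟩
    m % n + (m / n * n + o)        ∎)
    where open ≡-Reasoning

-- Half systems and least absolute residues

module HalfSystem (h : ℕ) where

  n : ℕ
  n = suc (2 * h)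

  ∤-small : ∀ {i} → 1 ≤ i → i ≤ 2 * h → ¬ (n ∣ i)
  ∤-small {suc i} _ i≤2h n∣i = <⇒≱ (s≤s i≤2h) (∣⇒≤ n∣i)

  h≤2h : h ≤ 2 * h
  h≤2h = m≤m+n h (h + 0)

  ∤-coprime : ∀ {b i} → Coprime b n → 1 ≤ i → i ≤ 2 * h → ¬ (n ∣ b * i)
  ∤-coprime {b} {i} cop 1≤i i≤2h n∣bi = ∤-small 1≤i i≤2h (coprime-divisor (Cop.sym cop) n∣bi)

  q-+ : ∀ X k → q n (X + k * n) ≡ q n X
  q-+ X k = trans (cong (λ z → parity (z / n)) (distrib X k n)) (parity-/-+ n (2 * X) k)
    where
    distrib : ∀ X k n → 2 * (X + k * n) ≡ 2 * X + 2 * k * n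
    distrib = solve-∀

  q-complement : ∀ {X Y} k → ¬ (n ∣ X) → X + Y ≡ k * n → q n X ⊕ q n Y ≡ 1ℙ
  q-complement {X} {Y} k n∤X eq = parity-/-complement n k
    (n∤X ∘ coprime-divisor (odd⇒coprime-2 (h , refl)))
    (trans (sym (*-distribˡ-+ 2 X Y)) (trans (cong (2 *_) eq) (sym (*-assoc 2 k n))))

  q-small : ∀ {X} → X ≤ h → q n X ≡ 0ℙ
  q-small X≤h = cong parity (m<n⇒m/n≡0 (s≤s (*-monoʳ-≤ 2 X≤h)))

  -- Here y ≡ X or y ≡ -X (mod n), with `q n X` recording the sign. The negative case is stated as a
  -- sum to avoid truncated subtraction.
  data Residue (X y : ℕ) : Set where
    pos : q n X ≡ 0ℙ → X % n ≡ y → Residue X y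
    neg : q n X ≡ 1ℙ → X % n + y ≡ n → Residue X y

  ∣_∣ₙ : ℕ → ℕ
  ∣ X ∣ₙ with X % n ≤? h
  ... | yes _ = X % n
  ... | no  _ = n ∸ X % n

  ∣∣ₙ-residue : ∀ {X} → ¬ (n ∣ X) → Residue X ∣ X ∣ₙ × 1 ≤ ∣ X ∣ₙ × ∣ X ∣ₙ ≤ h
  ∣∣ₙ-residue {X} n∤X with X % n ≤? h
  ... | yes r≤h = pos (trans (cong (q n) (m≡m%n+[m/n]*n X n)) (trans (q-+ (X % n) (X / n)) (q-small r≤h))) refl
                , n≢0⇒n>0 (n∤X ∘ m%n≡0⇒n∣m X n) , r≤h
  ... | no  r≰h = neg (trans (sym (ℙₚ.+-identityʳ _)) (trans (cong (q n X ⊕_) (sym (q-small y≤h)))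
                      (q-complement (suc (X / n)) n∤X sum-eq))) r+y≡n
                , m<n⇒0<n∸m (m%n<n X n) , y≤h
    where
    r+y≡n : X % n + (n ∸ X % n) ≡ n
    r+y≡n = m+[n∸m]≡n (m%n≤n X n)
    y≤h : n ∸ X % n ≤ h
    y≤h = ≤-trans (∸-monoʳ-≤ n (≰⇒> r≰h)) (≤-reflexive (trans (m+n∸m≡n h (h + 0)) (+-identityʳ h)))
    shuffle : ∀ r y k n → (r + k * n) + y ≡ (r + y) + k * n
    shuffle = solve-∀
    sum-eq : X + (n ∸ X % n) ≡ suc (X / n) * n
    sum-eq = trans (cong (_+ (n ∸ X % n)) (m≡m%n+[m/n]*n X n))
                   (trans (shuffle (X % n) _ (X / n) n) (cong (_+ X / n * n) r+y≡n))

  -- From X ≡ ±y follows aX ≡ ±ay, and negating a nonzero class flips `q`. Summed over the half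
  -- system, this identity gives multiplicativity of the symbol.
  q-scale : ∀ a {X y} → Residue X y → ¬ (n ∣ a * X) → q n (a * X) ≡ q n X ⊕ q n (a * y)
  q-scale a {X} {y} (pos qX r≡y) n∤ = begin
    q n (a * X)                            ≡⟨ cong (λ z → q n (a * z)) (m≡m%n+[m/n]*n X n) ⟩
    q n (a * (X % n + X / n * n))          ≡⟨ cong (λ z → q n (a * (z + X / n * n))) r≡y ⟩
    q n (a * (y + X / n * n))              ≡⟨ cong (q n) (distrib a y (X / n) n) ⟩
    q n (a * y + a * (X / n) * n)          ≡⟨ q-+ (a * y) (a * (X / n)) ⟩
    q n (a * y)                            ≡⟨ cong (_⊕ q n (a * y)) qX ⟨
    q n X ⊕ q n (a * y)                    ∎
    where
    open ≡-Reasoning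
    distrib : ∀ a y k n → a * (y + k * n) ≡ a * y + a * k * n
    distrib = solve-∀
  q-scale a {X} {y} (neg qX r+y≡n) n∤ = begin
    q n (a * X)
      ≡⟨ x⊕y≡z⇒y≡x⊕z {q n (a * y)} (trans (ℙₚ.+-comm (q n (a * y)) _) (q-complement (a * suc (X / n)) n∤ sum-eq)) ⟩
    q n (a * y) ⊕ 1ℙ     ≡⟨ ℙₚ.+-comm (q n (a * y)) 1ℙ ⟩
    1ℙ ⊕ q n (a * y)     ≡⟨ cong (_⊕ q n (a * y)) qX ⟨
    q n X ⊕ q n (a * y)  ∎
    where
    open ≡-Reasoning
    shuffle : ∀ a r y k n → a * (r + k * n) + a * y ≡ a * ((r + y) + k * n)
    shuffle = solve-∀
    sum-eq : a * X + a * y ≡ a * suc (X / n) * n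
    sum-eq = begin
      a * X + a * y                       ≡⟨ cong (λ z → a * z + a * y) (m≡m%n+[m/n]*n X n) ⟩
      a * (X % n + X / n * n) + a * y     ≡⟨ shuffle a (X % n) y (X / n) n ⟩
      a * ((X % n + y) + X / n * n)       ≡⟨ cong (λ z → a * (z + X / n * n)) r+y≡n ⟩
      a * (n + X / n * n)                 ≡⟨ *-assoc a (suc (X / n)) n ⟨
      a * suc (X / n) * n                 ∎

  module Multiplier {b : ℕ} (cop : Coprime b n) where

    φ : ℕ → ℕ
    φ i = ∣ b * i ∣ₙ

    φ-residue : ∀ {i} → 1 ≤ i → i ≤ h → Residue (b * i) (φ i) × 1 ≤ φ i × φ i ≤ h
    φ-residue 1≤i i≤h = ∣∣ₙ-residue (∤-coprime {b} cop 1≤i (≤-trans i≤h h≤2h))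

    -- If bi ≡ ±bj, then n divides b(i - j) or b(i + j), hence i - j or i + j; but both lie strictly
    -- between 0 and n.
    residue-injective : ∀ {i j y} → 1 ≤ j → j < i → i ≤ h →
                        Residue (b * i) y → Residue (b * j) y → ⊥
    residue-injective {i} {j} {y} 1≤j j<i i≤h = go
      where
      same : (b * i) % n ≡ (b * j) % n → ⊥
      same eq = ∤-coprime {b} cop (m<n⇒0<n∸m j<i) (≤-trans (m∸n≤m i j) (≤-trans i≤h h≤2h))
        (m%n≡[m+o]%n⇒n∣o (b * j) (b * (i ∸ j)) n (trans (sym eq)
          (cong (_% n) (trans (cong (b *_) (sym (m+[n∸m]≡n (<⇒≤ j<i)))) (*-distribˡ-+ b j (i ∸ j))))))
      opposite : (b * i) % n + (b * j) % n ≡ n → ⊥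
      opposite eq = ∤-coprime {b} cop (≤-trans 1≤j (m≤n+m j i))
        (+-mono-≤ i≤h (≤-trans (<⇒≤ j<i) (≤-trans i≤h (m≤m+n h 0))))
        (m%n≡0⇒n∣m _ n (begin
          (b * (i + j)) % n                    ≡⟨ cong (_% n) (*-distribˡ-+ b i j) ⟩
          (b * i + b * j) % n                  ≡⟨ %-distribˡ-+ (b * i) (b * j) n ⟩
          ((b * i) % n + (b * j) % n) % n      ≡⟨ cong (_% n) eq ⟩
          n % n                                ≡⟨ n%n≡0 n ⟩
          0                                    ∎))
        where open ≡-Reasoning
      go : Residue (b * i) y → Residue (b * j) y → ⊥
      go (pos _ e) (pos _ f) = same (trans e (sym f))
      go (neg _ e) (neg _ f) = same (+-cancelʳ-≡ y _ _ (trans e (sym f)))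
      go (pos _ e) (neg _ f) = opposite (trans (+-comm _ ((b * j) % n)) (trans (cong ((b * j) % n +_) e) f))
      go (neg _ e) (pos _ f) = opposite (trans (cong ((b * i) % n +_) f) e)

    φ-↭ : map φ (range h) ↭ range h
    φ-↭ = injective⇒↭ h φ (λ l u → proj₂ (φ-residue l u)) λ {i} {j} 1≤j j<i i≤h eq →
      residue-injective 1≤j j<i i≤h
        (subst (Residue (b * i)) eq (proj₁ (φ-residue (≤-trans 1≤j (<⇒≤ j<i)) i≤h)))
        (proj₁ (φ-residue 1≤j (≤-trans (<⇒≤ j<i) i≤h)))

  J≡ : ∀ a → J a n ≡ ∑ (λ i → q n (a * i)) (range h)
  J≡ a = cong (λ k → ∑ (λ i → q n (a * i)) (range k)) ([1+2h]/2≡h h)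

coprime-* : ∀ {a b n} → Coprime a n → Coprime b n → Coprime (a * b) n
coprime-* {a} {b} {n} ca cb {d} (d∣ab , d∣n) =
  cb (coprime-divisor {m = d} (λ (e∣d , e∣a) → ca (e∣a , ∣-trans e∣d d∣n)) d∣ab , d∣n)

-- `q-scale` with X = bi splits each term; the values `φ i` run through the half system again, so
-- the second sum is the one for a.
J-*ˡ : ∀ {a b n} → Odd n → Coprime a n → Coprime b n → J (a * b) n ≡ J a n ⊕ J b n
J-*ˡ {a} {b} (h , refl) ca cb = begin
  J (a * b) n                                               ≡⟨ J≡ (a * b) ⟩
  ∑ (λ i → q n (a * b * i)) (range h)                       ≡⟨ ∑-cong (range h) termwise ⟩
  ∑ (λ i → q n (b * i) ⊕ q n (a * φ i)) (range h)
    ≡⟨ ∑-⊕ (λ i → q n (b * i)) (λ i → q n (a * φ i)) (range h) ⟩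
  ∑ (λ i → q n (b * i)) (range h) ⊕ ∑ (λ i → q n (a * φ i)) (range h)
    ≡⟨ cong₂ _⊕_ (J≡ b) (trans (sym (∑-↭ (λ i → q n (a * i)) φ-↭)) (∑-map (λ i → q n (a * i)) φ (range h))) ⟨
  J b n ⊕ ∑ (λ i → q n (a * i)) (range h)                   ≡⟨ cong (J b n ⊕_) (J≡ a) ⟨
  J b n ⊕ J a n                                             ≡⟨ ℙₚ.+-comm (J b n) (J a n) ⟩
  J a n ⊕ J b n                                             ∎
  where
  open ≡-Reasoning
  open HalfSystem h
  open Multiplier {b} cb
  termwise : ∀ {i} → i ∈ range h → q n (a * b * i) ≡ q n (b * i) ⊕ q n (a * φ i)
  termwise {i} i∈ = let l , u = ∈-range⁻ i∈ in
    trans (cong (q n) (*-assoc a b i))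
      (q-scale a (proj₁ (φ-residue l u))
        (subst (λ z → ¬ (n ∣ z)) (*-assoc a b i) (∤-coprime {a * b} (coprime-* ca cb) l (≤-trans u h≤2h))))

J-+ˡ : ∀ {n} a k → Odd n → J (a + k * n) n ≡ J a n
J-+ˡ a k (h , refl) = trans (J≡ (a + k * n)) (trans (∑-cong (range h) λ {i} _ →
    trans (cong (q n) (distrib a k i n)) (q-+ (a * i) (k * i))) (sym (J≡ a)))
  where
  open HalfSystem h
  distrib : ∀ a k i n → (a + k * n) * i ≡ a * i + k * i * n
  distrib = solve-∀

-- Since b ≡ -a, all h terms flip, which is the factor (-1/n) = (-1)^h.
J-neg : ∀ {n} a b k → (o : Odd n) → Coprime a n → a + b ≡ k * n → J a n ≡ parity (proj₁ o) ⊕ J b n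
J-neg a b k (h , refl) ca eq = begin
  J a n                                                    ≡⟨ J≡ a ⟩
  ∑ (λ i → q n (a * i)) (range h)                          ≡⟨ ∑-complement (range h) termwise ⟩
  parity (length (range h)) ⊕ ∑ (λ i → q n (b * i)) (range h)
    ≡⟨ cong₂ _⊕_ (cong parity (length-applyDownFrom suc h)) (sym (J≡ b)) ⟩
  parity h ⊕ J b n                                         ∎
  where
  open ≡-Reasoning
  open HalfSystem h
  shuffle : ∀ k n i → k * n * i ≡ k * i * n
  shuffle = solve-∀
  termwise : ∀ {i} → i ∈ range h → q n (a * i) ⊕ q n (b * i) ≡ 1ℙ
  termwise {i} i∈ = let l , u = ∈-range⁻ i∈ in
    q-complement (k * i) (∤-coprime {a} ca l (≤-trans u h≤2h))
      (trans (sym (*-distribʳ-+ i a b)) (trans (cong (_* i) eq) (shuffle k n i)))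

J-1ˡ : ∀ {n} → Odd n → J 1 n ≡ 0ℙ
J-1ˡ (h , refl) = trans (J≡ 1) (trans (∑-cong (range h) λ {i} i∈ →
    trans (cong (q n) (*-identityˡ i)) (q-small (proj₂ (∈-range⁻ i∈)))) (∑-0 (range h)))
  where open HalfSystem h

-- Reciprocity

suc≢0 : ∀ {x} → suc x ≢ 0
suc≢0 ()

-- No lattice point of the rectangle lies on the line jn = 2ai, so each satisfies exactly one of j ≤
-- ⌊2ai/n⌋ and i ≤ ⌊jn/2a⌋. The upper argument is a successor because its predecessor bounds j.
J-dual : ∀ a h → Coprime (suc a) (suc (2 * h)) →
         J (suc a) (suc (2 * h)) ≡ ∑ (λ j → parity h ⊕ parity (j * suc (2 * h) / (2 * suc a))) (range a)
J-dual a′ h cop = begin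
  J a n                                                             ≡⟨ J≡ a ⟩
  ∑ (λ i → q n (a * i)) (range h)                                   ≡⟨ ∑-cong (range h) unfold ⟩
  ∑ (λ i → ∑ (λ j → [ j ≤ 2 * (a * i) / n ]?) (range a′)) (range h)
    ≡⟨ ∑-swap (λ i j → [ j ≤ 2 * (a * i) / n ]?) (range h) (range a′) ⟩
  ∑ (λ j → ∑ (λ i → [ j ≤ 2 * (a * i) / n ]?) (range h)) (range a′) ≡⟨ ∑-cong (range a′) refold ⟩
  ∑ (λ j → parity h ⊕ parity (j * n / (2 * a))) (range a′)          ∎
  where
  open ≡-Reasoning
  open HalfSystem h
  a = suc a′

  unfold : ∀ {i} → i ∈ range h → q n (a * i) ≡ ∑ (λ j → [ j ≤ 2 * (a * i) / n ]?) (range a′)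
  -- Since 2i < n, the floor of 2ai/n stays below a, and the minimum with a - 1 drops out.
  unfold {i} i∈ = sym (trans (∑-[≤] a′ (2 * (a * i) / n)) (cong parity (m≥n⇒m⊓n≡n (s≤s⁻¹ (m<n*o⇒m/o<n {n = a} below)))))
    where
    shuffle : ∀ a i → 2 * (a * i) ≡ a * (2 * i)
    shuffle = solve-∀
    below : 2 * (a * i) < a * n
    below = ≤-<-trans (≤-reflexive (shuffle a i)) (*-monoʳ-< a (s≤s (*-monoʳ-≤ 2 (proj₂ (∈-range⁻ i∈)))))

  refold : ∀ {j} → j ∈ range a′ →
           ∑ (λ i → [ j ≤ 2 * (a * i) / n ]?) (range h) ≡ parity h ⊕ parity (j * n / (2 * a))
  refold {j} j∈ = begin
    ∑ (λ i → [ j ≤ 2 * (a * i) / n ]?) (range h)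
      ≡⟨ ∑-complement (range h) exclusive ⟩
    parity (length (range h)) ⊕ ∑ (λ i → [ i ≤ j * n / (2 * a) ]?) (range h)
      ≡⟨ cong₂ _⊕_ (cong parity (length-applyDownFrom suc h)) (∑-[≤] h (j * n / (2 * a))) ⟩
    parity h ⊕ parity (h ⊓ (j * n / (2 * a)))
      ≡⟨ cong (λ z → parity h ⊕ parity z) (m≥n⇒m⊓n≡n (s≤s⁻¹ (m<n*o⇒m/o<n {n = suc h} below))) ⟩
    parity h ⊕ parity (j * n / (2 * a)) ∎
    where
    shuffle : ∀ a h → a * suc (suc (2 * h)) ≡ suc h * (2 * a)
    shuffle = solve-∀
    -- Bounds ⌊jn/2a⌋ by h: jn ≤ an < a(n + 1) = (h + 1)2a.
    below : j * n < suc h * (2 * a)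
    below = <-≤-trans (≤-<-trans (*-monoˡ-≤ n (m≤n⇒m≤1+n (proj₂ (∈-range⁻ j∈)))) (*-monoʳ-< a (n<1+n n)))
                      (≤-reflexive (shuffle a h))
    exclusive : ∀ {i} → i ∈ range h → [ j ≤ 2 * (a * i) / n ]? ⊕ [ i ≤ j * n / (2 * a) ]? ≡ 1ℙ
    exclusive {i} i∈ with j * n ≤? 2 * (a * i)
    -- Both bounds together would force jn = 2ai, so the odd n would divide ai, against coprimality
    -- and 1 ≤ i ≤ h.
    ... | yes jn≤ = cong₂ _⊕_ ([≤]-yes j (2 * (a * i) / n) (*≤⇒≤/ n j _ jn≤)) ([≤]-no i (j * n / (2 * a)) λ i≤ →
          ∤-coprime {a} cop (proj₁ (∈-range⁻ i∈)) (≤-trans (proj₂ (∈-range⁻ i∈)) h≤2h)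
            (coprime-divisor (odd⇒coprime-2 (h , refl))
              (divides j (sym (≤-antisym jn≤ (≤-trans (≤-reflexive (swap′ a i)) (≤/⇒*≤ (2 * a) i (j * n) i≤)))))))
      where
      swap′ : ∀ a i → 2 * (a * i) ≡ i * (2 * a)
      swap′ = solve-∀
    ... | no jn≰ = cong₂ _⊕_ ([≤]-no j (2 * (a * i) / n) (jn≰ ∘ ≤/⇒*≤ n j (2 * (a * i))))
          ([≤]-yes i (j * n / (2 * a)) (*≤⇒≤/ (2 * a) i (j * n) (≤-trans (≤-reflexive (swap′ a i)) (<⇒≤ (≰⇒> jn≰)))))
      where
      swap′ : ∀ a i → i * (2 * a) ≡ 2 * (a * i)
      swap′ = solve-∀

coprime-+ʳ : ∀ {a n} k → Coprime a n → Coprime a (n + k * a)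
coprime-+ʳ {a} {n} k cop {d} (d∣a , d∣n+ka) =
  cop (d∣a , ∣m+n∣m⇒∣n (subst (d ∣_) (+-comm n (k * a)) d∣n+ka) (∣n⇒∣m*n k d∣a))

coprime-+ˡ : ∀ {a n} k → Coprime a n → Coprime (a + k * n) n
coprime-+ˡ k cop = Cop.sym (coprime-+ʳ k (Cop.sym cop))

coprime-∣ʳ : ∀ {a m n} → m ∣ n → Coprime a n → Coprime a m
coprime-∣ʳ m∣n cop (d∣a , d∣m) = cop (d∣a , ∣-trans d∣m m∣n)

-- In the dual sum h grows by 2ma and each quotient by 2jm, both even.
J-+ʳ : ∀ {n} a m → Odd n → Coprime a n → J a (n + m * (4 * a)) ≡ J a n
J-+ʳ {n} zero m o cop = cong (J 0) (trans (cong (n +_) (*-zeroʳ m)) (+-identityʳ n))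
J-+ʳ a@(suc a′) m (h , refl) cop = begin
  J a (n + m * (4 * a))  ≡⟨ cong (J a) n+4am ⟩
  J a n′
    ≡⟨ J-dual a′ h′ (subst (Coprime a) (trans (cong (n +_) (*-assoc m 4 a)) n+4am) (coprime-+ʳ (m * 4) cop)) ⟩
  ∑ (λ j → parity h′ ⊕ parity (j * n′ / (2 * a))) (range a′)
    ≡⟨ ∑-cong (range a′) (λ {j} _ → cong₂ _⊕_ parity-h′ (termwise j)) ⟩
  ∑ (λ j → parity h ⊕ parity (j * n / (2 * a))) (range a′)    ≡⟨ J-dual a′ h cop ⟨
  J a n                  ∎
  where
  open ≡-Reasoning
  n = suc (2 * h)
  h′ = h + 2 * (m * a)
  n′ = suc (2 * h′)
  shift-n : ∀ h m a → suc (2 * h) + m * (4 * a) ≡ suc (2 * (h + 2 * (m * a)))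
  shift-n = solve-∀
  n+4am : n + m * (4 * a) ≡ n′
  n+4am = shift-n h m a
  parity-h′ : parity h′ ≡ parity h
  parity-h′ = trans (ℙₚ.+-homo-+ h (2 * (m * a))) (trans (cong (parity h ⊕_) (parity-2* (m * a))) (ℙₚ.+-identityʳ _))
  distrib : ∀ j n m a → j * (n + m * (4 * a)) ≡ j * n + 2 * (j * m) * (2 * a)
  distrib = solve-∀
  termwise : ∀ j → parity (j * n′ / (2 * a)) ≡ parity (j * n / (2 * a))
  termwise j = trans (cong (λ z → parity (z / (2 * a))) (trans (cong (j *_) (sym n+4am)) (distrib j n m a)))
                     (parity-/-+ (2 * a) (j * n) (j * m))

-- In the dual sum h + h′ = 2ma - 1 and the quotients for n and n′ sum to 2jm - 1. So both summands
-- of each term flip, and the flips cancel.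
J-reflect : ∀ {n n′} a m → Odd n → Odd n′ → Coprime a n → n + n′ ≡ m * (4 * a) → J a n ≡ J a n′
J-reflect zero m (h , refl) o′ cop eq = contradiction (trans eq (*-zeroʳ m)) suc≢0
J-reflect a@(suc a′) m (h , refl) (h′ , refl) cop eq = begin
  J a n                                                        ≡⟨ J-dual a′ h cop ⟩
  ∑ (λ j → parity h ⊕ parity (j * n / (2 * a))) (range a′)     ≡⟨ ∑-cong (range a′) termwise ⟩
  ∑ (λ j → parity h′ ⊕ parity (j * n′ / (2 * a))) (range a′)   ≡⟨ J-dual a′ h′ cop′ ⟨
  J a n′                                                       ∎
  where
  open ≡-Reasoning
  n = suc (2 * h)
  n′ = suc (2 * h′)
  cop′ : Coprime a n′
  cop′ {d} (d∣a , d∣n′) = cop (d∣a , ∣m+n∣m⇒∣n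
    (subst (d ∣_) (trans (sym eq) (+-comm n n′)) (∣n⇒∣m*n m (∣n⇒∣m*n 4 d∣a))) d∣n′)
  cop2 : Coprime (2 * a) n
  cop2 = coprime-* (Cop.sym (odd⇒coprime-2 (h , refl))) cop
  halves : suc (h + h′) ≡ 2 * (m * a)
  halves = *-cancelˡ-≡ _ _ 2 (trans (double h h′) (trans eq (regroup m a)))
    where
    double : ∀ h h′ → 2 * suc (h + h′) ≡ suc (2 * h) + suc (2 * h′)
    double = solve-∀
    regroup : ∀ m a → m * (4 * a) ≡ 2 * (2 * (m * a))
    regroup = solve-∀
  parity-h : parity h ⊕ parity h′ ≡ 1ℙ
  parity-h = trans (sym (ℙₚ.+-homo-+ h h′))
    (x⊕y≡z⇒y≡x⊕z {1ℙ} (trans (sym (parity-suc (h + h′))) (trans (cong parity halves) (parity-2* (m * a)))))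
  ⊕-lemma : ∀ x x′ y y′ → x ⊕ x′ ≡ 1ℙ → y ⊕ y′ ≡ 1ℙ → x ⊕ y ≡ x′ ⊕ y′
  ⊕-lemma 0ℙ 1ℙ 0ℙ 1ℙ _ _ = refl
  ⊕-lemma 0ℙ 1ℙ 1ℙ 0ℙ _ _ = refl
  ⊕-lemma 1ℙ 0ℙ 0ℙ 1ℙ _ _ = refl
  ⊕-lemma 1ℙ 0ℙ 1ℙ 0ℙ _ _ = refl
  regroup : ∀ j m a → j * (m * (4 * a)) ≡ 2 * (j * m) * (2 * a)
  regroup = solve-∀
  termwise : ∀ {j} → j ∈ range a′ →
             parity h ⊕ parity (j * n / (2 * a)) ≡ parity h′ ⊕ parity (j * n′ / (2 * a))
  termwise {j} j∈ = ⊕-lemma (parity h) (parity h′) (parity (j * n / (2 * a))) (parity (j * n′ / (2 * a)))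
    parity-h (parity-/-complement (2 * a) (j * m)
    -- 2a is coprime to n and 0 < j < 2a, so 2a does not divide jn.
    (λ 2a∣jn → below (coprime-divisor cop2 (subst (2 * a ∣_) (*-comm j n) 2a∣jn)))
    (trans (sym (*-distribˡ-+ j n n′)) (trans (cong (j *_) eq) (regroup j m a))))
    where
    below : ¬ (2 * a ∣ j)
    below 2a∣j = let l , u = ∈-range⁻ j∈ in
      <⇒≱ (s≤s (≤-trans u (m≤m+n a′ (a + 0)))) (∣⇒≤ {{>-nonZero l}} 2a∣j)

J-4 : ∀ {n} → Odd n → J 4 n ≡ 0ℙ
J-4 {n} o = trans (J-*ˡ {2} {2} o 2⊥n 2⊥n) (ℙₚ.p+p≡0ℙ (J 2 n))
  where
  2⊥n : Coprime 2 n
  2⊥n = Cop.sym (odd⇒coprime-2 o)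

J-4* : ∀ {n} a → Odd n → Coprime a n → J (4 * a) n ≡ J a n
J-4* {n} a o cop = trans (J-*ˡ {4} {a} o (coprime-* 2⊥n 2⊥n) cop) (cong (_⊕ J a n) (J-4 o))
  where
  2⊥n : Coprime 2 n
  2⊥n = Cop.sym (odd⇒coprime-2 o)

1+4*-odd : ∀ s → Odd (suc (4 * s))
1+4*-odd s = 2 * s , cong suc (*-assoc 2 2 s)

-- Euler's argument: 4a = v - d or 4a = d + v reduces both symbols to (a / ·).
reciprocity-≡1-≤ : ∀ s a → Coprime (suc (4 * s)) (suc (4 * (s + a))) →
                   J (suc (4 * s)) (suc (4 * (s + a))) ≡ J (suc (4 * (s + a))) (suc (4 * s))
reciprocity-≡1-≤ s a cop = begin
  -- d ≡ -4a (mod v), and (-1/v) = 1 because v ≡ 1 (mod 4).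
  J d v                            ≡⟨ J-neg d (4 * a) 1 odd-v cop d+4a ⟩
  parity (2 * (s + a)) ⊕ J (4 * a) v ≡⟨ cong (_⊕ J (4 * a) v) (parity-2* (s + a)) ⟩
  J (4 * a) v                      ≡⟨ J-4* a odd-v a⊥v ⟩
  J a v                            ≡⟨ cong (J a) v≡ ⟩
  J a (d + 1 * (4 * a))            ≡⟨ J-+ʳ a 1 odd-d a⊥d ⟩
  J a d                            ≡⟨ J-4* a odd-d a⊥d ⟨
  J (4 * a) d                      ≡⟨ J-+ˡ (4 * a) 1 odd-d ⟨
  J (4 * a + 1 * d) d
    ≡⟨ cong (λ z → J z d) (trans (+-comm (4 * a) (1 * d)) (trans (cong (_+ 4 * a) (*-identityˡ d)) (trans d+4a (*-identityˡ v)))) ⟩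
  J v d                            ∎
  where
  open ≡-Reasoning
  d = suc (4 * s)
  v = suc (4 * (s + a))
  odd-d = 1+4*-odd s
  odd-v = 1+4*-odd (s + a)
  expand : ∀ s a → suc (4 * s) + 4 * a ≡ 1 * suc (4 * (s + a))
  expand = solve-∀
  d+4a : d + 4 * a ≡ 1 * v
  d+4a = expand s a
  v≡ : v ≡ d + 1 * (4 * a)
  v≡ = trans (sym (*-identityˡ v)) (trans (sym d+4a) (cong (d +_) (sym (*-identityˡ (4 * a)))))
  a⊥d : Coprime a d
  a⊥d {e} (e∣a , e∣d) = cop (e∣d , subst (e ∣_) (trans d+4a (*-identityˡ v)) (∣m∣n⇒∣m+n e∣d (∣n⇒∣m*n 4 e∣a)))
  a⊥v : Coprime a v
  a⊥v {e} (e∣a , e∣v) = cop (∣m+n∣m⇒∣n (subst (e ∣_) (trans (sym (trans d+4a (*-identityˡ v))) (+-comm d (4 * a))) e∣v) (∣n⇒∣m*n 4 e∣a) , e∣v)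

-- `suc (2 * suc (2 * t))` is 4t + 3 in the shape that splitting h by parity produces. Here d ≡ 4a
-- (mod v) and v ≡ 4a (mod d), and `J-reflect` compares the two lower arguments.
reciprocity-≡3 : ∀ s t → Coprime (suc (4 * s)) (suc (2 * suc (2 * t))) →
                 J (suc (4 * s)) (suc (2 * suc (2 * t))) ≡ J (suc (2 * suc (2 * t))) (suc (4 * s))
reciprocity-≡3 s t cop = begin
  J d v            ≡⟨ J-+ˡ d 1 odd-v ⟨
  J (d + 1 * v) v  ≡⟨ cong (λ z → J z v) (trans (cong (d +_) (*-identityˡ v)) d+v) ⟩
  J (4 * a) v      ≡⟨ J-4* a odd-v a⊥v ⟩
  J a v            ≡⟨ J-reflect a 1 odd-d odd-v a⊥d (trans d+v (sym (*-identityˡ (4 * a)))) ⟨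
  J a d            ≡⟨ J-4* a odd-d a⊥d ⟨
  J (4 * a) d      ≡⟨ cong (λ z → J z d) (trans (cong (v +_) (*-identityˡ d)) (trans (+-comm v d) d+v)) ⟨
  J (v + 1 * d) d  ≡⟨ J-+ˡ v 1 odd-d ⟩
  J v d            ∎
  where
  open ≡-Reasoning
  d = suc (4 * s)
  v = suc (2 * suc (2 * t))
  a = s + suc t
  odd-d = 1+4*-odd s
  odd-v : Odd v
  odd-v = suc (2 * t) , refl
  expand : ∀ s t → suc (4 * s) + suc (2 * suc (2 * t)) ≡ 4 * (s + suc t)
  expand = solve-∀
  d+v : d + v ≡ 4 * a
  d+v = expand s t
  a⊥d : Coprime a d
  a⊥d {e} (e∣a , e∣d) = cop (e∣d , ∣m+n∣m⇒∣n (subst (e ∣_) (sym d+v) (∣n⇒∣m*n 4 e∣a)) e∣d)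
  a⊥v : Coprime a v
  a⊥v {e} (e∣a , e∣v) = cop (∣m+n∣m⇒∣n (subst (e ∣_) (trans (sym d+v) (+-comm d v)) (∣n⇒∣m*n 4 e∣a)) e∣v , e∣v)

even⊎odd : ∀ n → (∃ λ k → n ≡ 2 * k) ⊎ Odd n
even⊎odd zero = inj₁ (0 , refl)
even⊎odd (suc n) with even⊎odd n
... | inj₁ (k , refl) = inj₂ (k , refl)
... | inj₂ (k , refl) = inj₁ (suc k , cong suc (sym (+-suc k (k + 0))))

-- For v ≡ 1 (mod 4) the claim is symmetric in the two entries, so they may be ordered by size. For
-- v ≡ 3 (mod 4) their sum is divisible by 4.
reciprocity : ∀ {v} s → Odd v → Coprime (suc (4 * s)) v → J (suc (4 * s)) v ≡ J v (suc (4 * s))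
reciprocity s (h , refl) cop with even⊎odd h
... | inj₂ (t , refl) = reciprocity-≡3 s t cop
... | inj₁ (t , refl) = subst (λ v → J d v ≡ J v d) 4t≡ (≡1 (subst (Coprime d) (sym 4t≡) cop))
  where
  d = suc (4 * s)
  4t≡ : suc (4 * t) ≡ suc (2 * (2 * t))
  4t≡ = proj₂ (1+4*-odd t)
  ≡1 : Coprime d (suc (4 * t)) → J d (suc (4 * t)) ≡ J (suc (4 * t)) d
  ≡1 cop with ≤-total s t
  ... | inj₁ s≤t with a , refl ← m≤n⇒∃[o]m+o≡n s≤t = reciprocity-≡1-≤ s a cop
  ... | inj₂ t≤s with a , refl ← m≤n⇒∃[o]m+o≡n t≤s = sym (reciprocity-≡1-≤ t a (Cop.sym cop))

-- Take k = n(3a + 1): since n² ≡ 1 (mod 4), a + kn ≡ a + 3a + 1 ≡ 1.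
≡1-mod-4-representative : ∀ a {n} → Odd n → ∃₂ λ k s → a + k * n ≡ suc (4 * s)
≡1-mod-4-representative a (h , refl) = suc (2 * h) * (3 * a + 1) , a + (h + h * h) * (3 * a + 1) , expand a h
  where
  expand : ∀ a h → a + suc (2 * h) * (3 * a + 1) * suc (2 * h) ≡ suc (4 * (a + (h + h * h) * (3 * a + 1)))
  expand = solve-∀

odd-* : ∀ {m n} → Odd m → Odd n → Odd (m * n)
odd-* (h , refl) (k , refl) = h + k + 2 * (h * k) , expand h k
  where
  expand : ∀ h k → suc (2 * h) * suc (2 * k) ≡ suc (2 * (h + k + 2 * (h * k)))
  expand = solve-∀

-- Replace a by some d ≡ 1 (mod 4) in the same class modulo mn, hence modulo m and modulo n.
-- Reciprocity then moves the product to the upper argument, where additivity is known.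
J-*ʳ : ∀ {a m n} → Odd m → Odd n → Coprime a (m * n) → J a (m * n) ≡ J a m ⊕ J a n
J-*ʳ {a} {m} {n} om on cop with k , s , eq ← ≡1-mod-4-representative a (odd-* om on) = begin
  J a (m * n)              ≡⟨ J-+ˡ a k (odd-* om on) ⟨
  J (a + k * (m * n)) (m * n) ≡⟨ cong (λ z → J z (m * n)) eq ⟩
  J d (m * n)              ≡⟨ reciprocity s (odd-* om on) d⊥mn ⟩
  J (m * n) d              ≡⟨ J-*ˡ {m} {n} odd-d (Cop.sym d⊥m) (Cop.sym d⊥n) ⟩
  J m d ⊕ J n d            ≡⟨ cong₂ _⊕_ (reciprocity s om d⊥m) (reciprocity s on d⊥n) ⟨
  J d m ⊕ J d n
    ≡⟨ cong₂ _⊕_ (reduce m (k * n) om (mod-m k m n)) (reduce n (k * m) on (mod-n k m n)) ⟩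
  J a m ⊕ J a n            ∎
  where
  open ≡-Reasoning
  d = suc (4 * s)
  odd-d = 1+4*-odd s
  d⊥mn : Coprime d (m * n)
  d⊥mn = subst (λ z → Coprime z (m * n)) eq (coprime-+ˡ k cop)
  d⊥m : Coprime d m
  d⊥m = coprime-∣ʳ (m∣m*n n) d⊥mn
  d⊥n : Coprime d n
  d⊥n = coprime-∣ʳ (n∣m*n m) d⊥mn
  mod-m : ∀ k m n → k * (m * n) ≡ k * n * m
  mod-m = solve-∀
  mod-n : ∀ k m n → k * (m * n) ≡ k * m * n
  mod-n = solve-∀
  reduce : ∀ l c → Odd l → k * (m * n) ≡ c * l → J d l ≡ J a l
  reduce l c ol e = trans (cong (λ z → J z l) (trans (sym eq) (cong (a +_) e))) (J-+ˡ a c ol)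

-- Gauss's lemma and Euler's criterion

module _ (n : ℕ) .{{_ : NonZero n}} where

  %-cong-* : ∀ {a a′ b b′} → a % n ≡ a′ % n → b % n ≡ b′ % n → (a * b) % n ≡ (a′ * b′) % n
  %-cong-* {a} {a′} {b} {b′} p r =
    trans (%-distribˡ-* a b n) (trans (cong₂ (λ x y → (x * y) % n) p r) (sym (%-distribˡ-* a′ b′ n)))

  %-cancel-*-≤ : ∀ {a} x o → Coprime a n → (a * x) % n ≡ (a * (x + o)) % n → (x + o) % n ≡ x % n
  %-cancel-*-≤ {a} x o cop eq = %-remove-+ʳ x (coprime-divisor (Cop.sym cop)
    (m%n≡[m+o]%n⇒n∣o (a * x) (a * o) n (trans eq (cong (_% n) (*-distribˡ-+ a x o)))))

  %-cancel-* : ∀ {a x y} → Coprime a n → (a * x) % n ≡ (a * y) % n → x % n ≡ y % n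
  %-cancel-* {a} {x} {y} cop eq with ≤-total x y
  ... | inj₁ x≤y with o , refl ← m≤n⇒∃[o]m+o≡n x≤y = sym (%-cancel-*-≤ {a} x o cop eq)
  ... | inj₂ y≤x with o , refl ← m≤n⇒∃[o]m+o≡n y≤x = %-cancel-*-≤ {a} y o cop (sym eq)

  module _ (a : ℕ) where

    Partner : ℕ → ℕ → Set
    Partner x z = (x * z) % n ≡ a % n

    partner-sym : ∀ x z → Partner x z → Partner z x
    partner-sym x z p = trans (cong (_% n) (*-comm z x)) p

    -- Removing `x` together with its partner `z` contributes one factor a. `k` bounds the length
    -- for termination, because the remaining list `ys` is not a structural part of `xs`.
    product-of-pairs : ∀ k xs → length xs ≤ k → Unique xs →
      (∀ {x} → x ∈ xs → ∃ λ z → z ∈ xs × z ≢ x × Partner x z) →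
      (∀ {x z z′} → x ∈ xs → z ∈ xs → z′ ∈ xs → Partner x z → Partner x z′ → z ≡ z′) →
      ∃ λ m → length xs ≡ 2 * m × product xs % n ≡ a ^ m % n
    product-of-pairs k [] _ _ _ _ = 0 , refl , refl
    product-of-pairs (suc k) (x ∷ xs) (s≤s len) (x∉xs ∷ uniq) partner inj
      with z , z∈ , z≢x , xz ← partner (here refl)
      with ys , xs↭ ← ∈-extract (∈-tail z≢x z∈)
      with z∉ys ∷ uniq-ys ← Permutationₛ.Unique-resp-↭ (setoid ℕ) (↭⇒↭ₛ xs↭) uniq
      = let m , len≡ , prod≡ = product-of-pairs k ys (≤-trans (n≤1+n _) (≤-trans (≤-reflexive (sym (↭-length xs↭))) len))
                                 uniq-ys partner′ (λ p r s → inj (lift p) (lift r) (lift s))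
        in suc m , trans (cong suc (trans (↭-length xs↭) (cong suc len≡))) (double m) , (begin
             (x * product xs) % n        ≡⟨ cong (λ t → (x * t) % n) (product-↭ xs↭) ⟩
             (x * (z * product ys)) % n  ≡⟨ cong (_% n) (*-assoc x z (product ys)) ⟨
             (x * z * product ys) % n    ≡⟨ %-cong-* {x * z} {a} xz prod≡ ⟩
             (a * a ^ m) % n             ∎)
      where
      open ≡-Reasoning
      double : ∀ m → suc (suc (2 * m)) ≡ 2 * suc m
      double = solve-∀
      lift : ∀ {w} → w ∈ ys → w ∈ x ∷ xs
      lift w∈ = there (∈-resp-↭ (↭-sym xs↭) (there w∈))
      partner′ : ∀ {w} → w ∈ ys → ∃ λ w′ → w′ ∈ ys × w′ ≢ w × Partner w w′
      partner′ {w} w∈ with w′ , w′∈ , w′≢w , ww′ ← partner (lift w∈) =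
        w′ , ∈-tail w′≢z (∈-resp-↭ xs↭ (∈-tail w′≢x w′∈)) , w′≢w , ww′
        where
        w′≢x : w′ ≢ x
        -- Otherwise `w` and `z` would both be partners of `x`, forcing w = z.
        w′≢x refl = ∈⇒≢ z∉ys w∈ (inj (here refl) (lift w∈) z∈ (partner-sym w x ww′) xz)
        w′≢z : w′ ≢ z
        w′≢z refl = ∈⇒≢ x∉xs (∈-resp-↭ (↭-sym xs↭) (there w∈))
          (inj z∈ (lift w∈) (here refl) (partner-sym w z ww′) (partner-sym x z xz))

prime∧∤⇒coprime : ∀ {p a} → Prime p → ¬ (p ∣ a) → Coprime a p
prime∧∤⇒coprime pp p∤a (d∣a , d∣p) with prime⇒irreducible pp d∣p
... | inj₁ d≡1 = d≡1
... | inj₂ refl = contradiction d∣a p∤a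

module Gauss (h : ℕ) where

  open HalfSystem h

  -- 2h stands for -1 modulo n, which keeps Gauss's lemma within the natural numbers.
  sign : Parity → ℕ
  sign 0ℙ = 1
  sign 1ℙ = 2 * h

  sign-⊕ : ∀ x y → (sign x * sign y) % n ≡ sign (x ⊕ y) % n
  sign-⊕ 0ℙ y  = cong (_% n) (*-identityˡ (sign y))
  sign-⊕ 1ℙ 0ℙ = cong (_% n) (*-identityʳ (2 * h))
  sign-⊕ 1ℙ 1ℙ = begin
    (2 * h * (2 * h)) % n          ≡⟨ [m+kn]%n≡m%n (2 * h * (2 * h)) 1 n ⟨
    (2 * h * (2 * h) + 1 * n) % n  ≡⟨ cong (_% n) (square h) ⟩
    (1 + 2 * h * n) % n            ≡⟨ [m+kn]%n≡m%n 1 (2 * h) n ⟩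
    1 % n                          ∎
    where
    open ≡-Reasoning
    square : ∀ h → 2 * h * (2 * h) + 1 * suc (2 * h) ≡ 1 + 2 * h * suc (2 * h)
    square = solve-∀

  residue-% : ∀ {X y} → Residue X y → X % n ≡ (sign (q n X) * y) % n
  residue-% {X} {y} (pos qX r≡y) rewrite qX =
    trans (sym (m%n%n≡m%n X n)) (cong (_% n) (trans r≡y (sym (*-identityˡ y))))
  residue-% {X} {y} (neg qX r+y≡n) rewrite qX = begin
    X % n                  ≡⟨ m%n%n≡m%n X n ⟨
    -- Adding the multiple yn of n turns r into 2hy + (r + y), with r + y = n, and so avoids
    -- subtraction.
    X % n % n              ≡⟨ [m+kn]%n≡m%n (X % n) y n ⟨
    (X % n + y * n) % n    ≡⟨ cong (_% n) (expand (X % n) y h) ⟩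
    (2 * h * y + (X % n + y)) % n ≡⟨ cong (λ z → (2 * h * y + z) % n) r+y≡n ⟩
    (2 * h * y + n) % n    ≡⟨ [m+n]%n≡m%n (2 * h * y) n ⟩
    (2 * h * y) % n        ∎
    where
    open ≡-Reasoning
    expand : ∀ r y h → r + y * suc (2 * h) ≡ 2 * h * y + (r + y)
    expand = solve-∀

  product-map-* : ∀ b xs → product (map (b *_) xs) ≡ b ^ length xs * product xs
  product-map-* b [] = refl
  product-map-* b (x ∷ xs) = trans (cong (b * x *_) (product-map-* b xs)) (regroup b x (b ^ length xs) (product xs))
    where
    regroup : ∀ b x c d → b * x * (c * d) ≡ b * c * (x * d)
    regroup = solve-∀

  module _ {b : ℕ} (cop : Coprime b n) where

    open Multiplier {b} cop

    product-residues : ∀ xs → (∀ {i} → i ∈ xs → Residue (b * i) (φ i)) →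
      product (map (b *_) xs) % n ≡ (sign (∑ (λ i → q n (b * i)) xs) * product (map φ xs)) % n
    product-residues [] _ = refl
    product-residues (x ∷ xs) res = begin
      (b * x * product (map (b *_) xs)) % n
        ≡⟨ %-cong-* n {b * x} {s * φ x} (residue-% (res (here refl))) (product-residues xs (res ∘ there)) ⟩
      (s * φ x * (t * product (map φ xs))) % n ≡⟨ cong (_% n) (regroup s (φ x) t (product (map φ xs))) ⟩
      (s * t * (φ x * product (map φ xs))) % n
        ≡⟨ %-cong-* n {s * t} {sign (q n (b * x) ⊕ ∑ (λ i → q n (b * i)) xs)} {φ x * product (map φ xs)} {φ x * product (map φ xs)}
           (sign-⊕ (q n (b * x)) (∑ (λ i → q n (b * i)) xs)) refl ⟩
      (sign (q n (b * x) ⊕ ∑ (λ i → q n (b * i)) xs) * (φ x * product (map φ xs))) % n ∎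
      where
      open ≡-Reasoning
      s = sign (q n (b * x))
      t = sign (∑ (λ i → q n (b * i)) xs)
      regroup : ∀ s f t g → s * f * (t * g) ≡ s * t * (f * g)
      regroup = solve-∀

    -- The product of all bi is b^h h! on the one hand and, through the residues `φ i`, congruent to
    -- ±h! on the other; h! cancels by coprimality.
    gauss-lemma : Coprime (product (range h)) n → b ^ h % n ≡ sign (J b n) % n
    gauss-lemma cop! = %-cancel-* n cop! (begin
      (F * b ^ h) % n                  ≡⟨ cong (_% n) (*-comm F (b ^ h)) ⟩
      (b ^ h * F) % n                  ≡⟨ cong (λ l → (b ^ l * F) % n) (length-applyDownFrom suc h) ⟨
      (b ^ length (range h) * F) % n   ≡⟨ cong (_% n) (product-map-* b (range h)) ⟨
      product (map (b *_) (range h)) % n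
        ≡⟨ product-residues (range h) (λ i∈ → let l , u = ∈-range⁻ i∈ in proj₁ (φ-residue l u)) ⟩
      (sign (∑ (λ i → q n (b * i)) (range h)) * product (map φ (range h))) % n
        ≡⟨ cong₂ (λ x y → (sign x * y) % n) (sym (J≡ b)) (product-↭ φ-↭) ⟩
      (sign (J b n) * F) % n           ≡⟨ cong (_% n) (*-comm (sign (J b n)) F) ⟩
      (F * sign (J b n)) % n           ∎)
      where
      open ≡-Reasoning
      F = product (range h)

-- h is a successor, so that n ≥ 3 and 1 differs from -1 modulo n.
module Euler (k : ℕ) (prime-n : Prime (suc (2 * suc k))) where

  h : ℕ
  h = suc k

  open HalfSystem h
  open Gauss h

  range-coprime : ∀ {x} → 1 ≤ x → x ≤ 2 * h → Coprime x n
  range-coprime l u = prime∧∤⇒coprime prime-n (∤-small l u)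

  product-coprime : ∀ xs → (∀ {x} → x ∈ xs → Coprime x n) → Coprime (product xs) n
  product-coprime []       _   = Cop.1-coprimeTo n
  product-coprime (x ∷ xs) cop = coprime-* {x} (cop (here refl)) (product-coprime xs (cop ∘ there))

  inverse : ∀ {x} → Coprime x n → ∃ λ w → (x * w) % n ≡ 1 % n
  inverse {x} cop with Cop.coprime-Bézout cop
  ... | Bézout.+- w y eq = w , trans (cong (_% n) (trans (*-comm x w) (sym eq))) ([m+kn]%n≡m%n 1 y n)
  -- Here 1 + wx = yn, so w is inverse to -x; the factor 2h ≡ -1 corrects the sign.
  ... | Bézout.-+ w y eq = 2 * h * w , (begin
    (x * (2 * h * w)) % n          ≡⟨ [m+n]%n≡m%n (x * (2 * h * w)) n ⟨
    (x * (2 * h * w) + n) % n      ≡⟨ cong (_% n) (regroup x h w) ⟩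
    (1 + 2 * h * (1 + w * x)) % n  ≡⟨ cong (λ z → (1 + 2 * h * z) % n) eq ⟩
    (1 + 2 * h * (y * n)) % n      ≡⟨ cong (λ z → (1 + z) % n) (*-assoc (2 * h) y n) ⟨
    (1 + 2 * h * y * n) % n        ≡⟨ [m+kn]%n≡m%n 1 (2 * h * y) n ⟩
    1 % n                          ∎)
    where
    open ≡-Reasoning
    regroup : ∀ x h w → x * (2 * h * w) + suc (2 * h) ≡ 1 + 2 * h * (1 + w * x)
    regroup = solve-∀

  partner : ∀ a {x} → Coprime a n → Coprime x n → ∃ λ z → 1 ≤ z × z ≤ 2 * h × Partner n a x z
  partner a {x} a⊥n x⊥n with w , xw ← inverse x⊥n = z , n≢0⇒n>0 z≢0 , s≤s⁻¹ (m%n<n (w * a) n) , xz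
    where
    open ≡-Reasoning
    z = (w * a) % n
    xz : (x * z) % n ≡ a % n
    xz = begin
      (x * z) % n        ≡⟨ %-cong-* n {x} {x} {z} {w * a} refl (m%n%n≡m%n (w * a) n) ⟩
      (x * (w * a)) % n  ≡⟨ cong (_% n) (*-assoc x w a) ⟨
      (x * w * a) % n    ≡⟨ %-cong-* n {x * w} {1} {a} {a} xw refl ⟩
      (1 * a) % n        ≡⟨ cong (_% n) (*-identityˡ a) ⟩
      a % n              ∎
    z≢0 : z ≢ 0
    z≢0 z≡0 = <⇒≢ (s≤s (s≤s z≤n)) (sym (a⊥n (m%n≡0⇒n∣m a n (begin
      a % n        ≡⟨ xz ⟨
      (x * z) % n  ≡⟨ cong (λ t → (x * t) % n) z≡0 ⟩
      (x * 0) % n  ≡⟨ cong (_% n) (*-zeroʳ x) ⟩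
      0            ∎) , ∣-refl)))

  partner-unique : ∀ a {x z z′} → Coprime x n → z ≤ 2 * h → z′ ≤ 2 * h →
                   Partner n a x z → Partner n a x z′ → z ≡ z′
  partner-unique a {x} {z} {z′} x⊥n u u′ p p′ = begin
    z      ≡⟨ m<n⇒m%n≡m (s≤s u) ⟨
    z % n  ≡⟨ %-cancel-* n x⊥n (trans p (sym p′)) ⟩
    z′ % n ≡⟨ m<n⇒m%n≡m (s≤s u′) ⟩
    z′     ∎
    where open ≡-Reasoning

  -- If a is not a square, the pairing xz ≡ a on 1, ..., n - 1 has no fixed point and consists of h
  -- pairs.
  nonsquare⇒product : ∀ {a} → Coprime a n → (∀ x → x < n → (x * x) % n ≢ a % n) →
                      product (range (2 * h)) % n ≡ a ^ h % n
  nonsquare⇒product {a} a⊥n nonsquare =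
    trans (proj₂ (proj₂ pairs)) (cong (λ t → a ^ t % n) (*-cancelˡ-≡ (proj₁ pairs) h 2
      (trans (sym (proj₁ (proj₂ pairs))) (length-applyDownFrom suc (2 * h)))))
    where
    ⊥n : ∀ {x} → x ∈ range (2 * h) → Coprime x n
    ⊥n x∈ = let l , u = ∈-range⁻ x∈ in range-coprime l u
    partner∈ : ∀ {x} → x ∈ range (2 * h) → ∃ λ z → z ∈ range (2 * h) × z ≢ x × Partner n a x z
    partner∈ {x} x∈ = let z , l , u , xz = partner a a⊥n (⊥n x∈) in
      z , ∈-range⁺ l u
        , (λ z≡x → nonsquare x (s≤s (proj₂ (∈-range⁻ x∈))) (subst (Partner n a x) z≡x xz)) , xz
    pairs = product-of-pairs n a (2 * h) (range (2 * h)) (≤-reflexive (length-applyDownFrom suc (2 * h)))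
      (range-unique (2 * h)) partner∈
      (λ x∈ z∈ z′∈ → partner-unique a (⊥n x∈) (proj₂ (∈-range⁻ z∈)) (proj₂ (∈-range⁻ z′∈)))

  -- Apart from 1 and 2h ≡ -1 no residue is its own inverse, so the factors in between pair off with
  -- product 1.
  wilson : product (range (2 * h)) % n ≡ (2 * h) % n
  wilson = begin
    product (range (2 * h)) % n                 ≡⟨ cong (λ t → product (range t) % n) 2h≡ ⟩
    (2+2k * product (range (suc (2 * k)))) % n
      ≡⟨ cong (λ l → (2+2k * product l) % n) (applyDownFrom-∷ʳ suc (2 * k)) ⟨
    (2+2k * product (middle ++ 1 ∷ [])) % n
      ≡⟨ cong (λ t → (2+2k * t) % n) (trans (product-++ middle (1 ∷ [])) (*-identityʳ (product middle))) ⟩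
    (2+2k * product middle) % n
      ≡⟨ %-cong-* n {2+2k} {2+2k} {product middle} {1} refl (trans (proj₂ (proj₂ pairs)) (cong (_% n) (^-zeroˡ (proj₁ pairs)))) ⟩
    (2+2k * 1) % n                              ≡⟨ cong (_% n) (trans (*-identityʳ 2+2k) (sym 2h≡)) ⟩
    (2 * h) % n                                 ∎
    where
    open ≡-Reasoning
    2+2k = suc (suc (2 * k))
    2h≡ : 2 * h ≡ 2+2k
    2h≡ = double k
      where
      double : ∀ k → 2 * suc k ≡ suc (suc (2 * k))
      double = solve-∀
    middle = applyDownFrom (suc ∘ suc) (2 * k)
    middle-unique : Unique middle
    middle-unique = Uniqueₚ.applyDownFrom⁺₁ (suc ∘ suc) (2 * k) λ j<i _ eq → <⇒≢ j<i (sym (suc-injective (suc-injective eq)))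
    bounds : ∀ {x} → x ∈ middle → 2 ≤ x × x < 2 * h
    bounds x∈ with i , i<2k , refl ← ∈-applyDownFrom⁻ (suc ∘ suc) x∈ =
      s≤s (s≤s z≤n) , ≤-trans (s≤s (s≤s i<2k)) (≤-reflexive (sym 2h≡))
    ∈-middle : ∀ {x} → 2 ≤ x → x < 2 * h → x ∈ middle
    ∈-middle {suc (suc x)} (s≤s (s≤s _)) u = ∈-applyDownFrom⁺ (suc ∘ suc) (s≤s⁻¹ (s≤s⁻¹ (≤-trans u (≤-reflexive 2h≡))))
    ⊥n : ∀ {x} → x ∈ middle → Coprime x n
    ⊥n x∈ = let l , u = bounds x∈ in range-coprime (≤-trans (s≤s z≤n) l) (<⇒≤ u)
    1%n : 1 % n ≡ 1
    1%n = m<n⇒m%n≡m {n = n} {m = 1} (s≤s (s≤s z≤n))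
    factor : ∀ y → suc y * suc y ≡ 1 + y * suc (suc y)
    factor = solve-∀
    no-square-root : ∀ {x} → 2 ≤ x → x < 2 * h → (x * x) % n ≢ 1 % n
    -- With x = y + 1, n divides x² - 1 = y(y + 2) and hence a factor, but both factors lie strictly
    -- between 0 and n.
    no-square-root {suc y} (s≤s 1≤y) u xx with euclidsLemma y (suc (suc y)) prime-n
          (m%n≡[m+o]%n⇒n∣o 1 (y * suc (suc y)) n (trans (sym xx) (cong (_% n) (factor y))))
    ... | inj₁ n∣y   = ∤-small 1≤y (≤-trans (n≤1+n y) (<⇒≤ u)) n∣y
    ... | inj₂ n∣2+y = ∤-small (s≤s z≤n) u n∣2+y
    partner∈ : ∀ {x} → x ∈ middle → ∃ λ z → z ∈ middle × z ≢ x × Partner n 1 x z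
    partner∈ {x} x∈ = let z , l , u , xz = partner 1 (Cop.1-coprimeTo n) (⊥n x∈) in
      z , ∈-middle (≤∧≢⇒< l (z≢1 xz ∘ sym)) (≤∧≢⇒< u (z≢2h xz))
        , (λ z≡x → no-square-root 2≤x x<2h (subst (Partner n 1 x) z≡x xz)) , xz
      where
      2≤x = proj₁ (bounds x∈)
      x<2h = proj₂ (bounds x∈)
      z≢1 : ∀ {z} → Partner n 1 x z → z ≢ 1
      z≢1 xz refl = <⇒≢ 2≤x (sym (begin
        x            ≡⟨ m<n⇒m%n≡m (s≤s (<⇒≤ x<2h)) ⟨
        x % n        ≡⟨ cong (_% n) (*-identityʳ x) ⟨
        (x * 1) % n  ≡⟨ xz ⟩
        1 % n        ≡⟨ 1%n ⟩
        1            ∎))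
      z≢2h : ∀ {z} → Partner n 1 x z → z ≢ 2 * h
      -- z ≡ -1 would give x ≡ -1, so that n divides x + 1 ≤ 2h.
      z≢2h xz refl = ∤-small (s≤s z≤n) x<2h (m%n≡0⇒n∣m (suc x) n (begin
        suc x % n                            ≡⟨ %-distribˡ-+ 1 x n ⟩
        (1 % n + x % n) % n                  ≡⟨ cong (λ t → (t + x % n) % n) xz ⟨
        ((x * (2 * h)) % n + x % n) % n      ≡⟨ %-distribˡ-+ (x * (2 * h)) x n ⟨
        (x * (2 * h) + x) % n                ≡⟨ cong (_% n) (trans (+-comm _ x) (sym (*-suc x (2 * h)))) ⟩
        (x * n) % n                          ≡⟨ m*n%n≡0 x n ⟩
        0                                    ∎))
    pairs = product-of-pairs n 1 (length middle) middle ≤-refl middle-unique partner∈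
      (λ x∈ z∈ z′∈ → partner-unique 1 (⊥n x∈) (<⇒≤ (proj₂ (bounds z∈))) (<⇒≤ (proj₂ (bounds z′∈))))

  square⇒J≡0 : ∀ {a x} → Coprime a n → (x * x) % n ≡ a % n → J a n ≡ 0ℙ
  square⇒J≡0 {a} {x} a⊥n eq = begin
    J a n                ≡⟨ J-% a ⟩
    J (a % n) n          ≡⟨ cong (λ z → J z n) eq ⟨
    J ((x * x) % n) n    ≡⟨ J-% (x * x) ⟨
    J (x * x) n          ≡⟨ J-*ˡ {x} {x} (h , refl) x⊥n x⊥n ⟩
    J x n ⊕ J x n        ≡⟨ ℙₚ.p+p≡0ℙ (J x n) ⟩
    0ℙ                   ∎
    where
    open ≡-Reasoning
    J-% : ∀ a → J a n ≡ J (a % n) n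
    J-% a = trans (cong (λ z → J z n) (m≡m%n+[m/n]*n a n)) (J-+ˡ (a % n) (a / n) (h , refl))
    x⊥n : Coprime x n
    x⊥n = prime∧∤⇒coprime prime-n λ n∣x → <⇒≢ (s≤s (s≤s z≤n)) (sym (a⊥n
      (m%n≡0⇒n∣m a n (trans (sym eq) (n∣m⇒m%n≡0 (x * x) n (∣m⇒∣m*n x n∣x))) , ∣-refl)))

  -- If `J a n` were 0, Gauss's lemma would give a^h ≡ 1, whereas the pairing and Wilson's theorem
  -- give a^h ≡ (n - 1)! ≡ -1.
  nonsquare⇒J≡1 : ∀ {a} → Coprime a n → (∀ x → x < n → (x * x) % n ≢ a % n) → J a n ≡ 1ℙ
  nonsquare⇒J≡1 {a} a⊥n nonsquare with J a n in Ja
  ... | 1ℙ = refl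
  ... | 0ℙ = contradiction 2h≡1 (even≢odd h 0)
    where
    open ≡-Reasoning
    2h≡1 : 2 * h ≡ 1
    2h≡1 = begin
      2 * h                        ≡⟨ m<n⇒m%n≡m (n<1+n (2 * h)) ⟨
      (2 * h) % n                  ≡⟨ wilson ⟨
      product (range (2 * h)) % n  ≡⟨ nonsquare⇒product a⊥n nonsquare ⟩
      a ^ h % n
        ≡⟨ gauss-lemma a⊥n (product-coprime (range h) λ x∈ → let l , u = ∈-range⁻ x∈ in range-coprime l (≤-trans u h≤2h)) ⟩
      sign (J a n) % n             ≡⟨ cong (λ t → sign t % n) Ja ⟩
      1 % n                        ≡⟨ m<n⇒m%n≡m {n = n} {m = 1} (s≤s (s≤s z≤n)) ⟩
      1                            ∎

-- The Kronecker symbol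

⟦_⟧ : Parity → ℤ
⟦ 0ℙ ⟧ = 1ℤ
⟦ 1ℙ ⟧ = -1ℤ

⟦⟧-⊕ : ∀ x y → ⟦ x ⊕ y ⟧ ≡ ⟦ x ⟧ ℤ.* ⟦ y ⟧
⟦⟧-⊕ 0ℙ 0ℙ = refl
⟦⟧-⊕ 0ℙ 1ℙ = refl
⟦⟧-⊕ 1ℙ 0ℙ = refl
⟦⟧-⊕ 1ℙ 1ℙ = refl

isSquareMod⁻ : ∀ a m → isSquareMod a (suc m) ≡ true → ∃ λ x → (x * x) % suc m ≡ a % suc m
isSquareMod⁻ a m eq =
  let x , _ , t = find (any⁻ _ (upTo (suc m)) (subst T (sym eq) _)) in x , ≡ᵇ⇒≡ _ _ t

isSquareMod⁺ : ∀ a m x → x < suc m → (x * x) % suc m ≡ a % suc m → isSquareMod a (suc m) ≢ false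
isSquareMod⁺ a m x x<n eq ≡false =
  subst T ≡false (any⁺ (λ x → (x * x) % suc m ≡ᵇ a % suc m) (lose (∈-upTo⁺ x<n) (≡⇒≡ᵇ _ _ eq)))

square⇒J≡0 : ∀ {m a} → Prime (suc m) → Odd (suc m) → Coprime a (suc m) →
             isSquareMod a (suc m) ≡ true → J a (suc m) ≡ 0ℙ
square⇒J≡0 pp (zero  , refl) cop eq = refl
square⇒J≡0 {a = a} pp (suc k , refl) cop eq = let x , xx = isSquareMod⁻ a (2 * suc k) eq in Euler.square⇒J≡0 k pp {x = x} cop xx

nonsquare⇒J≡1 : ∀ {m a} → Prime (suc m) → Odd (suc m) → Coprime a (suc m) →
                isSquareMod a (suc m) ≡ false → J a (suc m) ≡ 1ℙ
nonsquare⇒J≡1 pp (zero  , refl) cop eq = contradiction pp ¬prime[1]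
nonsquare⇒J≡1 {a = a} pp (suc k , refl) cop eq =
  Euler.nonsquare⇒J≡1 k pp cop λ x x<n xx → isSquareMod⁺ a (2 * suc k) x x<n xx eq

-- Splitting p down to 3 + m lets `kronPrime` reduce past its clause for 2.
kronPrime-coprime : ∀ {p a} → Prime p → Odd p → Coprime a p → kronPrime a p ≡ ⟦ J a p ⟧
kronPrime-coprime {0} pp _ _ = contradiction pp ¬prime[0]
kronPrime-coprime {1} pp _ _ = contradiction pp ¬prime[1]
kronPrime-coprime {2} pp (h , eq) _ = contradiction eq (even≢odd 1 h)
kronPrime-coprime {p@(suc (suc (suc m)))} {a} pp odd cop
  rewrite dec-false (p ∣? a) (λ p∣a → suc≢0 (suc-injective (cop (p∣a , ∣-refl))))
  with isSquareMod a p in eq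
... | true  = cong ⟦_⟧ (sym (square⇒J≡0 pp odd cop eq))
... | false = cong ⟦_⟧ (sym (nonsquare⇒J≡1 pp odd cop eq))

kronPrime-∣ : ∀ {p a} → Odd p → 2 ≤ p → p ∣ a → kronPrime a p ≡ 0ℤ
kronPrime-∣ {1} _ (s≤s ()) _
kronPrime-∣ {2} (h , eq) _ _ = contradiction eq (even≢odd 1 h)
kronPrime-∣ {p@(suc (suc (suc m)))} {a} odd _ p∣a rewrite dec-true (p ∣? a) p∣a = refl

-- Roughness records that no number from 2 to d - 1 divides n, so the first divisor met is prime.
-- `n ≤ d + k` keeps the fuel sufficient: when it runs out, d = n.
findDiv-prime : ∀ k {d n} → 2 ≤ n → 2 ≤ d → d Rough n → n ≤ d + k → Prime (findDiv k d n) × findDiv k d n ∣ n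
findDiv-prime zero {d} {n} 2≤n 2≤d rough n≤d+0 =
  rough∧∣⇒prime {{n>1⇒nonTrivial 2≤n}} (subst (_Rough n) d≡n rough) ∣-refl , ∣-refl
  where
  d≡n : d ≡ n
  d≡n = ≤-antisym (rough⇒≤ {{n>1⇒nonTrivial 2≤n}} rough) (≤-trans n≤d+0 (≤-reflexive (+-identityʳ d)))
findDiv-prime (suc k) {d} {n} 2≤n 2≤d rough n≤d+k with d ∣? n
... | yes d∣n = rough∧∣⇒prime {{n>1⇒nonTrivial 2≤d}} rough d∣n , d∣n
... | no  d∤n = findDiv-prime k 2≤n (m≤n⇒m≤1+n 2≤d) (∤⇒rough-suc d∤n rough) (≤-trans n≤d+k (≤-reflexive (+-suc d k)))

-- The prime factor is given as a successor so that the local `quot` reduces to division.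
kronAux-unfold : ∀ f a m {r s} → minPrimeFactor (2+ m) ≡ suc r → 2+ m ≡ s * suc r →
                 kronAux (suc f) a (2+ m) ≡ kronPrime a (suc r) ℤ.* kronAux f a s
kronAux-unfold f a m {r} {s} mpf eq rewrite mpf =
  cong (λ z → kronPrime a (suc r) ℤ.* kronAux f a z) (trans (cong (_/ suc r) eq) (m*n/n≡m s (suc r)))

-- One recursion step seen as a factorisation of n: `s≤f` keeps the remaining fuel sufficient, and
-- `1≤s` excludes the special value at 0.
record Step (f a n : ℕ) : Set where
  field
    {p s} : ℕ
    prime-p : Prime p
    n≡p*s   : n ≡ p * s
    s≤f     : s ≤ f
    1≤s     : 1 ≤ s
    unfold  : kronAux (suc f) a n ≡ kronPrime a p ℤ.* kronAux f a s

kronAux-step : ∀ f a n → 2 ≤ n → n ≤ suc f → Step f a n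
kronAux-step f a 1 (s≤s ()) _
kronAux-step f a n@(2+ m) 2≤n n≤1+f with minPrimeFactor n in mpf | findDiv-prime n {2} {n} 2≤n ≤-refl 2-rough (m≤n+m n 2)
... | zero  | pp , _ = contradiction pp ¬prime[0]
... | suc r | pp , r∣n@(divides s eq) = record
  { prime-p = pp
  ; n≡p*s   = trans eq (*-comm s (suc r))
  ; s≤f     = s≤s⁻¹ (≤-trans (quotient-< r∣n {{prime⇒nonTrivial pp}}) n≤1+f)
  ; 1≤s     = n≢0⇒n>0 λ { refl → suc≢0 eq }
  ; unfold  = kronAux-unfold f a m {s = s} mpf eq
  }

odd-∣ : ∀ {d n} → d ∣ n → Odd n → Odd d
odd-∣ {d} d∣n odd with even⊎odd d
... | inj₂ odd-d = odd-d
... | inj₁ (k , refl) = contradiction (odd⇒coprime-2 odd (∣-trans (m∣m*n k) d∣n , ∣-refl)) λ ()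

coprime-*ʳ : ∀ {a m n} → Coprime a m → Coprime a n → Coprime a (m * n)
coprime-*ʳ {a} {m} {n} cm cn = Cop.sym (coprime-* {m} {n} (Cop.sym cm) (Cop.sym cn))

prime⇒2≤ : ∀ {p} → Prime p → 2 ≤ p
prime⇒2≤ {p} pp = nonTrivial⇒n>1 p {{prime⇒nonTrivial pp}}

kronAux-coprime : ∀ f {a n} → n ≤ f → Odd n → Coprime a n → kronAux f a n ≡ ⟦ J a n ⟧
kronAux-coprime f {n = 0} _ (_ , ()) _
kronAux-coprime f {n = 1} _ _ _ = refl
kronAux-coprime (suc f) {a} {n@(2+ _)} n≤f odd cop = begin
  kronAux (suc f) a n                  ≡⟨ unfold ⟩
  kronPrime a p ℤ.* kronAux f a s      ≡⟨ cong₂ ℤ._*_ (kronPrime-coprime prime-p odd-p (coprime-∣ʳ p∣n cop))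
                                                       (kronAux-coprime f s≤f odd-s (coprime-∣ʳ s∣n cop)) ⟩
  ⟦ J a p ⟧ ℤ.* ⟦ J a s ⟧              ≡⟨ ⟦⟧-⊕ (J a p) (J a s) ⟨
  ⟦ J a p ⊕ J a s ⟧                    ≡⟨ cong ⟦_⟧ (J-*ʳ odd-p odd-s (subst (Coprime a) n≡p*s cop)) ⟨
  ⟦ J a (p * s) ⟧                      ≡⟨ cong (λ z → ⟦ J a z ⟧) n≡p*s ⟨
  ⟦ J a n ⟧                            ∎
  where
  open ≡-Reasoning
  open Step (kronAux-step f a n (s≤s (s≤s z≤n)) n≤f)
  p∣n : p ∣ n
  p∣n = subst (p ∣_) (sym n≡p*s) (m∣m*n s)
  s∣n : s ∣ n
  s∣n = subst (s ∣_) (sym n≡p*s) (n∣m*n p)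
  odd-p = odd-∣ p∣n odd
  odd-s = odd-∣ s∣n odd

-- Either p divides a and the first factor is 0, or a is coprime to p, hence not to s, and the
-- second factor is 0.
kronAux-¬coprime : ∀ f {a n} → n ≤ f → Odd n → ¬ Coprime a n → kronAux f a n ≡ 0ℤ
kronAux-¬coprime f {n = 0} _ (_ , ()) _
kronAux-¬coprime f {a} {n = 1} _ _ ¬cop = ⊥-elim (¬cop (Cop.sym (Cop.1-coprimeTo a)))
kronAux-¬coprime (suc f) {a} {n@(2+ _)} n≤f odd ¬cop with Step.p step ∣? a
  where step = kronAux-step f a n (s≤s (s≤s z≤n)) n≤f
... | yes p∣a = trans unfold (cong (ℤ._* kronAux f a s)
        (kronPrime-∣ (odd-∣ (subst (p ∣_) (sym n≡p*s) (m∣m*n s)) odd) (prime⇒2≤ prime-p) p∣a))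
  where open Step (kronAux-step f a n (s≤s (s≤s z≤n)) n≤f)
... | no p∤a = trans unfold (trans (cong (kronPrime a p ℤ.*_)
        (kronAux-¬coprime f s≤f (odd-∣ (subst (s ∣_) (sym n≡p*s) (n∣m*n p)) odd)
        λ a⊥s → ¬cop (subst (Coprime a) (sym n≡p*s) (coprime-*ʳ (prime∧∤⇒coprime prime-p p∤a) a⊥s)))) (ℤₚ.*-zeroʳ (kronPrime a p)))
  where open Step (kronAux-step f a n (s≤s (s≤s z≤n)) n≤f)

kronPrime-2-≡1 : ∀ a → a % 2 ≡ 1 → a % 8 ≡ 1 → kronPrime a 2 ≡ 1ℤ
kronPrime-2-≡1 a eq₂ eq₈ rewrite eq₂ | eq₈ = refl

kronPrime-2-≡5 : ∀ a → a % 2 ≡ 1 → a % 8 ≡ 5 → kronPrime a 2 ≡ -1ℤ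
kronPrime-2-≡5 a eq₂ eq₈ rewrite eq₂ | eq₈ = refl

-- `J 2` has period 8 = 4 * 2 in its lower argument, and (d/2) depends on d modulo 8 only, so it
-- suffices to compare at 1 and 5.
kronPrime-2 : ∀ s → kronPrime (suc (4 * s)) 2 ≡ ⟦ J 2 (suc (4 * s)) ⟧
kronPrime-2 s with even⊎odd s
... | inj₁ (t , refl) = trans (cong (λ z → kronPrime z 2) (form t)) (trans value
        (cong ⟦_⟧ (trans (sym (J-+ʳ 2 t (0 , refl) (Cop.sym (Cop.1-coprimeTo 2)))) (cong (J 2) (sym (form t))))))
  where
  form : ∀ t → suc (4 * (2 * t)) ≡ 1 + t * 8
  form = solve-∀
  mod2 : ∀ t → 1 + t * 8 ≡ 1 + t * 4 * 2
  mod2 = solve-∀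
  value : kronPrime (1 + t * 8) 2 ≡ 1ℤ
  value = kronPrime-2-≡1 (1 + t * 8) (trans (cong (_% 2) (mod2 t)) ([m+kn]%n≡m%n 1 (t * 4) 2)) ([m+kn]%n≡m%n 1 t 8)
... | inj₂ (t , refl) = trans (cong (λ z → kronPrime z 2) (form t)) (trans value
        (cong ⟦_⟧ (trans (sym (J-+ʳ 2 t (2 , refl) (Cop.sym (odd⇒coprime-2 (2 , refl))))) (cong (J 2) (sym (form t))))))
  where
  form : ∀ t → suc (4 * suc (2 * t)) ≡ 5 + t * 8
  form = solve-∀
  mod2 : ∀ t → 5 + t * 8 ≡ 1 + (2 + t * 4) * 2
  mod2 = solve-∀
  value : kronPrime (5 + t * 8) 2 ≡ -1ℤ
  value = kronPrime-2-≡5 (5 + t * 8) (trans (cong (_% 2) (mod2 t)) ([m+kn]%n≡m%n 1 (2 + t * 4) 2)) ([m+kn]%n≡m%n 5 t 8)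

kronPrime-reciprocity : ∀ s {p} → Prime p → Coprime (suc (4 * s)) p → kronPrime (suc (4 * s)) p ≡ ⟦ J p (suc (4 * s)) ⟧
kronPrime-reciprocity s {p} pp cop with even⊎odd p
... | inj₂ odd = trans (kronPrime-coprime pp odd cop) (cong ⟦_⟧ (reciprocity s odd cop))
... | inj₁ (k , refl) with prime⇒irreducible pp {2} (m∣m*n k)
...   | inj₂ 2≡p = subst (λ p → kronPrime (suc (4 * s)) p ≡ ⟦ J p (suc (4 * s)) ⟧) 2≡p (kronPrime-2 s)

-- With the prime 2 included, reciprocity for d ≡ 1 (mod 4) extends to even n. It serves to evaluate
-- (a/b), where b may be even.
kronAux-reciprocity : ∀ f s {n} → 1 ≤ n → n ≤ f → Coprime (suc (4 * s)) n →
                      kronAux f (suc (4 * s)) n ≡ ⟦ J n (suc (4 * s)) ⟧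
kronAux-reciprocity f s {1} _ _ _ = cong ⟦_⟧ (sym (J-1ˡ (1+4*-odd s)))
kronAux-reciprocity (suc f) s {n@(2+ _)} _ n≤f cop = begin
  kronAux (suc f) d n                  ≡⟨ unfold ⟩
  kronPrime d p ℤ.* kronAux f d t
    ≡⟨ cong₂ ℤ._*_ (kronPrime-reciprocity s prime-p d⊥p) (kronAux-reciprocity f s 1≤s s≤f d⊥t) ⟩
  ⟦ J p d ⟧ ℤ.* ⟦ J t d ⟧              ≡⟨ ⟦⟧-⊕ (J p d) (J t d) ⟨
  ⟦ J p d ⊕ J t d ⟧                    ≡⟨ cong ⟦_⟧ (J-*ˡ {p} {t} (1+4*-odd s) (Cop.sym d⊥p) (Cop.sym d⊥t)) ⟨
  ⟦ J (p * t) d ⟧                      ≡⟨ cong (λ z → ⟦ J z d ⟧) n≡p*s ⟨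
  ⟦ J n d ⟧                            ∎
  where
  open ≡-Reasoning
  d = suc (4 * s)
  open Step (kronAux-step f d n (s≤s (s≤s z≤n)) n≤f) renaming (s to t)
  d⊥p : Coprime d p
  d⊥p = coprime-∣ʳ (subst (p ∣_) (sym n≡p*s) (m∣m*n t)) cop
  d⊥t : Coprime d t
  d⊥t = coprime-∣ʳ (subst (t ∣_) (sym n≡p*s) (n∣m*n p)) cop

-- The action of Γ₁(4)

coprime-^ʳ : ∀ {a b} N → Coprime a b → Coprime a (b ^ N)
coprime-^ʳ {a} zero    _   = Cop.sym (Cop.1-coprimeTo a)
coprime-^ʳ {a} {b} (suc N) cop = coprime-*ʳ {a} {b} cop (coprime-^ʳ N cop)

-- k is the part of x coprime to d.
coprime-part : ∀ d x → 1 ≤ x → ∃₂ λ k N → Coprime k d × x ∣ k * d ^ N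
coprime-part d = <-rec (λ x → 1 ≤ x → ∃₂ λ k N → Coprime k d × x ∣ k * d ^ N) step
  where
  step : ∀ x → (∀ {y} → y < x → 1 ≤ y → ∃₂ λ k N → Coprime k d × y ∣ k * d ^ N) →
         1 ≤ x → ∃₂ λ k N → Coprime k d × x ∣ k * d ^ N
  step x rec 1≤x with gcd x d in g≡ | gcd[m,n]∣m x d | gcd[m,n]∣n x d
  ... | 0 | 0∣x | _ = contradiction (0∣⇒≡0 0∣x) (>⇒≢ 1≤x)
  ... | 1 | _ | _ = x , 0 , Cop.gcd≡1⇒coprime g≡ , m∣m*n 1
  ... | g@(2+ _) | g∣x@(divides y x≡yg) | g∣d
    with k , N , cop , y∣ ← rec {y} (quotient-< g∣x {{_}} {{>-nonZero 1≤x}}) (n≢0⇒n>0 λ { refl → >⇒≢ 1≤x x≡yg })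
    = k , suc N , cop , subst₂ _∣_ (sym x≡yg) (regroup k d (d ^ N)) (*-pres-∣ y∣ g∣d)
    where
    regroup : ∀ k d e → k * e * d ≡ k * (d * e)
    regroup = solve-∀

-- Let k be the part of x coprime to d. Then d + kn is coprime to k, since d is, and to d, since kn
-- is; and x divides some k d^N.
coprime-shift : ∀ {d n x} → 1 ≤ x → Coprime d n → ∃ λ k → Coprime (d + k * n) x
coprime-shift {d} {n} {x} 1≤x d⊥n with k , N , k⊥d , x∣ ← coprime-part d x 1≤x =
  k , coprime-∣ʳ x∣ (coprime-*ʳ {d + k * n} {k} ⊥k (coprime-^ʳ N ⊥d))
  where
  ⊥k : Coprime (d + k * n) k
  ⊥k {e} (e∣ , e∣k) = k⊥d (e∣k , ∣m+n∣m⇒∣n (subst (e ∣_) (+-comm d (k * n)) e∣) (∣m⇒∣m*n n e∣k))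
  ⊥d : Coprime (d + k * n) d
  ⊥d {e} (e∣ , e∣d) = coprime-*ʳ {d} {k} (Cop.sym k⊥d) d⊥n (e∣d , ∣m+n∣m⇒∣n e∣ e∣d)

module Action (a b c d : ℕ) (det : a * d ≡ b * c + 1) (x y : ℕ) where

  u v : ℕ
  u = a * x + b * y
  v = c * x + d * y

  -- The inverse matrix applied to (u, v), with the negative term moved across.
  d*u≡b*v+x : d * u ≡ b * v + x
  d*u≡b*v+x = trans (expand a b d x y) (trans (cong (λ z → z * x + b * d * y) det) (regroup b c d x y))
    where
    expand : ∀ a b d x y → d * (a * x + b * y) ≡ a * d * x + b * d * y
    expand = solve-∀
    regroup : ∀ b c d x y → (b * c + 1) * x + b * d * y ≡ b * (c * x + d * y) + x
    regroup = solve-∀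

  a*v≡c*u+y : a * v ≡ c * u + y
  a*v≡c*u+y = trans (expand a c d x y) (trans (cong (λ z → z * y + a * c * x) det) (regroup a b c x y))
    where
    expand : ∀ a c d x y → a * (c * x + d * y) ≡ a * d * y + a * c * x
    expand = solve-∀
    regroup : ∀ a b c x y → (b * c + 1) * y + a * c * x ≡ c * (a * x + b * y) + y
    regroup = solve-∀

  coprime⁺ : Coprime x y → Coprime u v
  coprime⁺ x⊥y {e} (e∣u , e∣v) = x⊥y
    ( ∣m+n∣m⇒∣n (subst (e ∣_) d*u≡b*v+x (∣n⇒∣m*n d e∣u)) (∣n⇒∣m*n b e∣v)
    , ∣m+n∣m⇒∣n (subst (e ∣_) a*v≡c*u+y (∣n⇒∣m*n a e∣v)) (∣n⇒∣m*n c e∣u) )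

  coprime⁻ : Coprime u v → Coprime x y
  coprime⁻ u⊥v (e∣x , e∣y) = u⊥v
    (∣m∣n⇒∣m+n (∣n⇒∣m*n a e∣x) (∣n⇒∣m*n b e∣y) , ∣m∣n⇒∣m+n (∣n⇒∣m*n c e∣x) (∣n⇒∣m*n d e∣y))

module Matrix (s b c′ t : ℕ) (det : suc (4 * s) * suc (4 * t) ≡ b * (c′ * 4) + 1) where

  a c d : ℕ
  a = suc (4 * s)
  c = c′ * 4
  d = suc (4 * t)

  odd-a : Odd a
  odd-a = 1+4*-odd s

  odd-d : Odd d
  odd-d = 1+4*-odd t

  b⊥ad : Coprime b (a * d)
  b⊥ad {e} (e∣b , e∣ad) = ∣1⇒≡1 (∣m+n∣m⇒∣n (subst (e ∣_) det e∣ad) (∣m⇒∣m*n c e∣b))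

  b⊥d : Coprime b d
  b⊥d = coprime-∣ʳ (n∣m*n a) b⊥ad

  c⊥d : Coprime c d
  c⊥d {e} (e∣c , e∣d) = ∣1⇒≡1 (∣m+n∣m⇒∣n (subst (e ∣_) det (∣n⇒∣m*n a e∣d)) (∣n⇒∣m*n b e∣c))

  -- The determinant gives bc ≡ -1 (mod d), and (-1/d) = 1 because d ≡ 1 (mod 4).
  J-c≡J-b : J c d ≡ J b d
  J-c≡J-b = begin
    J c d              ≡⟨ x⊕y≡z⇒y≡x⊕z {J b d} (trans (sym (J-*ˡ {b} {c} odd-d b⊥d c⊥d)) J-bc≡0) ⟩
    J b d ⊕ 0ℙ         ≡⟨ ℙₚ.+-identityʳ (J b d) ⟩
    J b d              ∎
    where
    open ≡-Reasoning
    J-bc≡0 : J (b * c) d ≡ 0ℙ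
    J-bc≡0 = begin
      J (b * c) d               ≡⟨ J-neg (b * c) 1 a odd-d (coprime-* {b} {c} b⊥d c⊥d) (sym det) ⟩
      parity (2 * t) ⊕ J 1 d    ≡⟨ cong₂ _⊕_ (parity-2* t) (J-1ˡ odd-d) ⟩
      0ℙ                        ∎

  -- Since 4 divides c, ad ≡ 1 (mod 4b), so (b/ad) = (b/1) = 1.
  J-b-a≡J-b-d : J b a ≡ J b d
  J-b-a≡J-b-d = begin
    J b a
      ≡⟨ x⊕y≡z⇒y≡x⊕z {J b d} (trans (ℙₚ.+-comm (J b d) (J b a)) (trans (sym (J-*ʳ odd-a odd-d b⊥ad)) J-ad≡0)) ⟩
    J b d ⊕ 0ℙ         ≡⟨ ℙₚ.+-identityʳ (J b d) ⟩
    J b d              ∎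
    where
    open ≡-Reasoning
    regroup : ∀ b c′ → b * (c′ * 4) + 1 ≡ 1 + c′ * (4 * b)
    regroup = solve-∀
    J-ad≡0 : J b (a * d) ≡ 0ℙ
    J-ad≡0 = begin
      J b (a * d)                 ≡⟨ cong (J b) (trans det (regroup b c′)) ⟩
      J b (1 + c′ * (4 * b))      ≡⟨ J-+ʳ b c′ (0 , refl) (Cop.sym (Cop.1-coprimeTo b)) ⟩
      0ℙ                          ∎

  kronecker-a-b : kronecker a b ≡ ⟦ J b d ⟧
  kronecker-a-b = trans (lemma b refl) (cong ⟦_⟧ J-b-a≡J-b-d)
    where
    lemma : ∀ b′ → b′ ≡ b → kronecker a b′ ≡ ⟦ J b′ a ⟧
    -- For b = 0 the determinant forces a = 1, and (1/0) = 1.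
    lemma zero refl = subst (λ z → kronecker z 0 ≡ ⟦ J 0 z ⟧) (sym (m*n≡1⇒m≡1 a d det)) refl
    lemma b@(suc _) refl = kronAux-reciprocity b s (s≤s z≤n) ≤-refl (Cop.sym (coprime-∣ʳ (m∣m*n d) b⊥ad))

  module _ (x : ℕ) {y : ℕ} (odd-y : Odd y) where

    open Action a b c d det x y

    v≡dy+4c′x : v ≡ d * y + c′ * (4 * x)
    v≡dy+4c′x = regroup c′ d x y
      where
      regroup : ∀ c′ d x y → c′ * 4 * x + d * y ≡ d * y + c′ * (4 * x)
      regroup = solve-∀

    odd-v : Odd v
    odd-v with h , eq ← odd-* odd-d odd-y = h + c′ * 2 * x , trans v≡dy+4c′x (trans (cong (_+ c′ * (4 * x)) eq) (regroup h c′ x))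
      where
      regroup : ∀ h c′ x → suc (2 * h) + c′ * (4 * x) ≡ suc (2 * (h + c′ * 2 * x))
      regroup = solve-∀

    -- From d u = x + b v and v = c x + d y one gets (d/v)(u/v) = (x/v) = (x/d)(x/y)
    -- and (d/v) = (v/d) = (c/d)(x/d) = (b/d)(x/d).
    J-image-coprime : Coprime x y → Coprime d x → J u v ≡ J b d ⊕ J x y
    J-image-coprime x⊥y d⊥x = cancel (J b d) (J x d) (J u v) (J x y) (begin
      (J b d ⊕ J x d) ⊕ J u v  ≡⟨ cong (_⊕ J u v) J-d-v ⟨
      J d v ⊕ J u v            ≡⟨ J-*ˡ {d} {u} odd-v d⊥v (coprime⁺ x⊥y) ⟨
      J (d * u) v              ≡⟨ cong (λ z → J z v) (trans d*u≡b*v+x (+-comm (b * v) x)) ⟩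
      J (x + b * v) v          ≡⟨ J-+ˡ x b odd-v ⟩
      J x v                    ≡⟨ cong (J x) v≡dy+4c′x ⟩
      J x (d * y + c′ * (4 * x)) ≡⟨ J-+ʳ x c′ (odd-* odd-d odd-y) x⊥dy ⟩
      J x (d * y)              ≡⟨ J-*ʳ odd-d odd-y x⊥dy ⟩
      J x d ⊕ J x y            ∎)
      where
      open ≡-Reasoning
      cancel : ∀ β ξ υ η → (β ⊕ ξ) ⊕ υ ≡ ξ ⊕ η → υ ≡ β ⊕ η
      cancel β ξ υ η eq = begin
        υ                       ≡⟨ x⊕y≡z⇒y≡x⊕z {β ⊕ ξ} eq ⟩
        (β ⊕ ξ) ⊕ (ξ ⊕ η)       ≡⟨ ℙₚ.+-assoc β ξ (ξ ⊕ η) ⟩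
        β ⊕ (ξ ⊕ (ξ ⊕ η))       ≡⟨ cong (β ⊕_) (x⊕x⊕y≡y ξ η) ⟩
        β ⊕ η                   ∎
      x⊥dy : Coprime x (d * y)
      x⊥dy = coprime-*ʳ {x} {d} (Cop.sym d⊥x) x⊥y
      cx⊥d : Coprime (c * x) d
      cx⊥d = coprime-* {c} {x} c⊥d (Cop.sym d⊥x)
      v≡ : v ≡ c * x + y * d
      v≡ = cong (c * x +_) (*-comm d y)
      d⊥v : Coprime d v
      d⊥v = Cop.sym (subst (λ z → Coprime z d) (sym v≡) (coprime-+ˡ {c * x} y cx⊥d))
      J-d-v : J d v ≡ J b d ⊕ J x d
      J-d-v = begin
        J d v                 ≡⟨ reciprocity t odd-v d⊥v ⟩
        J v d                 ≡⟨ cong (λ z → J z d) v≡ ⟩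
        J (c * x + y * d) d   ≡⟨ J-+ˡ (c * x) y odd-d ⟩
        J (c * x) d           ≡⟨ J-*ˡ {c} {x} odd-d c⊥d (Cop.sym d⊥x) ⟩
        J c d ⊕ J x d         ≡⟨ cong (_⊕ J x d) J-c≡J-b ⟩
        J b d ⊕ J x d         ∎

-- Adding 4k times the first row to the second changes neither side, and makes d coprime to x.
J-image : ∀ s b c′ t → suc (4 * s) * suc (4 * t) ≡ b * (c′ * 4) + 1 → ∀ x {y} → Odd y → Coprime x y →
          J (suc (4 * s) * x + b * y) (c′ * 4 * x + suc (4 * t) * y) ≡ J b (suc (4 * t)) ⊕ J x y
-- For x = 0 coprimality forces y = 1, so that u = b and v = d.
J-image s b c′ t det zero {y} odd-y 0⊥y with refl ← Cop.0-coprimeTo-m⇒m≡1 0⊥y = begin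
  J (suc (4 * s) * 0 + b * 1) (c′ * 4 * 0 + suc (4 * t) * 1)
    ≡⟨ cong₂ J (simplify (suc (4 * s)) b) (simplify (c′ * 4) (suc (4 * t))) ⟩
  J b (suc (4 * t))                                      ≡⟨ ℙₚ.+-identityʳ _ ⟨
  J b (suc (4 * t)) ⊕ 0ℙ                                 ∎
  where
  open ≡-Reasoning
  simplify : ∀ a b → a * 0 + b * 1 ≡ b
  simplify = solve-∀
J-image s b c′ t det x@(suc _) {y} odd-y x⊥y = begin
  J u v                      ≡⟨ J-+ʳ u k (odd-v x odd-y) (coprime⁺ x⊥y) ⟨
  J u (v + k * (4 * u))      ≡⟨ cong (J u) (shift-v s b c′ t k x y) ⟩
  J u ((c′ + k * a) * 4 * x + suc (4 * (t + k * b)) * y)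
                             ≡⟨ Matrix.J-image-coprime s b (c′ + k * a) (t + k * b) det′ x odd-y x⊥y (subst (λ z → Coprime z x) (shift-d t b k) shifted) ⟩
  J b (suc (4 * (t + k * b))) ⊕ J x y ≡⟨ cong (λ z → J b z ⊕ J x y) (shift-d t b k) ⟨
  J b (d + k * (4 * b)) ⊕ J x y ≡⟨ cong (_⊕ J x y) (J-+ʳ b k odd-d b⊥d) ⟩
  J b d ⊕ J x y              ∎
  where
  open ≡-Reasoning
  open Matrix s b c′ t det using (odd-d; b⊥d; odd-v)
  open Action (suc (4 * s)) b (c′ * 4) (suc (4 * t)) det x y
  a = suc (4 * s)
  d = suc (4 * t)
  d⊥4b : Coprime d (4 * b)
  d⊥4b = coprime-*ʳ {d} {4} (coprime-*ʳ {d} {2} (odd⇒coprime-2 odd-d) (odd⇒coprime-2 odd-d)) (Cop.sym b⊥d)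
  k = proj₁ (coprime-shift {x = x} (s≤s z≤n) d⊥4b)
  shifted = proj₂ (coprime-shift {x = x} (s≤s z≤n) d⊥4b)
  shift-d : ∀ t b k → suc (4 * t) + k * (4 * b) ≡ suc (4 * (t + k * b))
  shift-d = solve-∀
  shift-v : ∀ s b c′ t k x y → c′ * 4 * x + suc (4 * t) * y + k * (4 * (suc (4 * s) * x + b * y))
          ≡ (c′ + k * suc (4 * s)) * 4 * x + suc (4 * (t + k * b)) * y
  shift-v = solve-∀
  det′ : a * suc (4 * (t + k * b)) ≡ b * ((c′ + k * a) * 4) + 1
  det′ = trans (expand a t k b) (trans (cong (_+ a * (4 * (k * b))) det) (regroup a b c′ k))
    where
    expand : ∀ a t k b → a * suc (4 * (t + k * b)) ≡ a * suc (4 * t) + a * (4 * (k * b))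
    expand = solve-∀
    regroup : ∀ a b c′ k → b * (c′ * 4) + 1 + a * (4 * (k * b)) ≡ b * ((c′ + k * a) * 4) + 1
    regroup = solve-∀

-- Determinant 1 preserves common divisors, so outside the coprime case both sides are 0. Both
-- directions of the theorem are read off from this formula.
kronecker-image : ∀ s b c′ t → suc (4 * s) * suc (4 * t) ≡ b * (c′ * 4) + 1 → ∀ x {y} → Odd y →
                  kronecker (suc (4 * s) * x + b * y) (c′ * 4 * x + suc (4 * t) * y)
                  ≡ kronecker (suc (4 * s)) b ℤ.* kronecker x y
kronecker-image s b c′ t det x {y} odd-y with Cop.coprime? x y
... | yes x⊥y = begin
  kronecker u v                    ≡⟨ kronAux-coprime v ≤-refl (odd-v x odd-y) (coprime⁺ x⊥y) ⟩
  ⟦ J u v ⟧                        ≡⟨ cong ⟦_⟧ (J-image s b c′ t det x odd-y x⊥y) ⟩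
  ⟦ J b (suc (4 * t)) ⊕ J x y ⟧    ≡⟨ ⟦⟧-⊕ (J b (suc (4 * t))) (J x y) ⟩
  ⟦ J b (suc (4 * t)) ⟧ ℤ.* ⟦ J x y ⟧ ≡⟨ cong₂ ℤ._*_ kronecker-a-b (kronAux-coprime y ≤-refl odd-y x⊥y) ⟨
  kronecker (suc (4 * s)) b ℤ.* kronecker x y ∎
  where
  open ≡-Reasoning
  open Matrix s b c′ t det
  open Action (suc (4 * s)) b (c′ * 4) (suc (4 * t)) det x y
... | no ¬x⊥y = begin
  kronecker u v
    ≡⟨ kronAux-¬coprime v ≤-refl (odd-v x odd-y) (λ u⊥v → ¬x⊥y (coprime⁻ u⊥v)) ⟩
  0ℤ                               ≡⟨ ℤₚ.*-zeroʳ (kronecker (suc (4 * s)) b) ⟨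
  kronecker (suc (4 * s)) b ℤ.* 0ℤ
    ≡⟨ cong (kronecker (suc (4 * s)) b ℤ.*_) (kronAux-¬coprime y ≤-refl odd-y ¬x⊥y) ⟨
  kronecker (suc (4 * s)) b ℤ.* kronecker x y ∎
  where
  open ≡-Reasoning
  open Matrix s b c′ t det
  open Action (suc (4 * s)) b (c′ * 4) (suc (4 * t)) det x y

%4≡1⇒ : ∀ {a} → a % 4 ≡ 1 → ∃ λ s → a ≡ suc (4 * s)
%4≡1⇒ {a} eq = a / 4 , trans (m≡m%n+[m/n]*n a 4) (cong₂ _+_ eq (*-comm (a / 4) 4))

%2≡1⇒odd : ∀ {y} → y % 2 ≡ 1 → Odd y
%2≡1⇒odd {y} eq = y / 2 , trans (m≡m%n+[m/n]*n y 2) (cong₂ _+_ eq (*-comm (y / 2) 2))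

theorem2p2 : (a b c d : ℕ)
    → a * d ≡ b * c + 1
    → a % 4 ≡ 1 → d % 4 ≡ 1 → 4 ∣ c
    → (((x y : ℕ) → y % 2 ≡ 1
    → kronecker x y ≡ kronecker (a * x + b * y) (c * x + d * y))
    → kronecker a b ≡ 1ℤ)
    × (kronecker a b ≡ 1ℤ
    → ((x y : ℕ) → y % 2 ≡ 1
    → kronecker x y ≡ kronecker (a * x + b * y) (c * x + d * y)))
theorem2p2 a b c d det a≡1 d≡1 (divides c′ refl)
  with s , refl ← %4≡1⇒ {a} a≡1 | t , refl ← %4≡1⇒ {d} d≡1
  = (λ invariant → begin
      -- At the pair (0, 1), where (0/1) = 1, the formula isolates (a/b).
      kronecker a b                              ≡⟨ ℤₚ.*-identityʳ (kronecker a b) ⟨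
      kronecker a b ℤ.* kronecker 0 1            ≡⟨ kronecker-image s b c′ t det 0 (0 , refl) ⟨
      kronecker (a * 0 + b * 1) (c * 0 + d * 1)  ≡⟨ invariant 0 1 refl ⟨
      1ℤ                                         ∎)
  , (λ ab≡1 x y y-odd → begin
      kronecker x y                              ≡⟨ ℤₚ.*-identityˡ (kronecker x y) ⟨
      1ℤ ℤ.* kronecker x y                       ≡⟨ cong (ℤ._* kronecker x y) ab≡1 ⟨
      kronecker a b ℤ.* kronecker x y            ≡⟨ kronecker-image s b c′ t det x (%2≡1⇒odd y-odd) ⟨
      kronecker (a * x + b * y) (c * x + d * y)  ∎)
  where open ≡-Reasoning
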